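{- Let $m, n \in \mathbb{N}$ with $m \geq 5$ and $n \geq 2$. Let $G$ be the disjoint union of cycles $C_{k_1},\ldots,C_{k_n}$ with each $k_i \geq 3$, and let $M = K_1 \vee G$. Then $P_{DP}(M,m) = P(M,m)$. Consequently, $\tau_{DP}(M) \leq 5$.
   Context: All graphs are finite and simple; $K_1 \vee G$ is the join of a single vertex with $G$. A cover of a graph $G$ is a pair $\mathcal{H}=(L,H)$ where $H$ is a graph and $L: V(G) \to \mathcal{P}(V(H))$ satisfies: (1) $\{L(u): u \in V(G)\}$ is a partition of $V(H)$ into $|V(G)|$ parts; (2) $H[L(u)]$ is complete for each $u$; (3) if there is an edge of $H$ between $L(u)$ and $L(v)$ with $u \neq v$, then $uv \in E(G)$; (4) if $uv \in E(G)$, the edges of $H$ between $L(u)$ and $L(v)$ form a (possibly empty) matching. The cover is $m$-fold if $|L(u)|=m$ for all $u$. An $\mathcal{H}$-coloring is an independent set of $H$ of size $|V(G)|$. $P_{DP}(G,m)$ is the minimum number of $\mathcal{H}$-colorings over all $m$-fold covers; $P(G,m)$ is the chromatic polynomial. $\tau_{DP}(G)$ is the smallest $N \geq \chi(G)$ such that $P_{DP}(G,m)=P(G,m)$ for all $m \geq N$ (and $\infty$ if no such $N$ exists). -}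

module Defs where

open import Data.Nat using (ℕ; zero; suc; _+_; _≤_; _≡ᵇ_)
open import Data.Bool using (Bool; true; false; _∨_; _∧_; not)
open import Data.Bool.Properties using (∨-comm)
open import Data.Fin using (Fin; zero; suc; toℕ; splitAt; _≟_)
open import Data.Fin.Subset using (Subset; _∈_; ∣_∣)
open import Data.Fin.Subset.Properties using (_∈?_)
open import Data.Fin.Properties using (all?)
open import Data.Vec using (Vec; []; _∷_; lookup)
open import Data.List using (List; []; _∷_; [_]; map; concatMap; filter; length)
open import Data.Product using (Σ; ∃; _×_; _,_)
open import Data.Sum using (inj₁; inj₂)
open import Relation.Binary.PropositionalEquality using (_≡_; _≢_; refl; sym; cong₂)
open import Relation.Nullary using (Dec; yes; no; ¬_; _→-dec_; _×-dec_; ¬?)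
open import Relation.Nullary.Decidable using (⌊_⌋)
import Data.Nat.Properties as ℕP
import Data.Bool.Properties as BP

record Graph : Set where
  field
    n      : ℕ
    adj    : Fin n → Fin n → Bool
    adj-sym : ∀ x y → adj x y ≡ adj y x
    adj-irrefl : ∀ x → adj x x ≡ false

open Graph public

Edge : (G : Graph) → Fin (n G) → Fin (n G) → Set
Edge G u w = adj G u w ≡ true

private
  ≟-sym : ∀ {k} (i j : Fin k) → ⌊ i ≟ j ⌋ ≡ ⌊ j ≟ i ⌋
  ≟-sym i j with i ≟ j | j ≟ i
  ... | yes _ | yes _ = refl
  ... | no _  | no _  = refl
  ... | yes p | no q  = Data.Empty.⊥-elim (q (sym p))
    where import Data.Empty
  ... | no p  | yes q = Data.Empty.⊥-elim (p (sym q))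
    where import Data.Empty

  ≟-refl : ∀ {k} (i : Fin k) → ⌊ i ≟ i ⌋ ≡ true
  ≟-refl i with i ≟ i
  ... | yes _ = refl
  ... | no p  = Data.Empty.⊥-elim (p refl)
    where import Data.Empty

fromRel : (k : ℕ) → (Fin k → Fin k → Bool) → Graph
fromRel k r = record
  { n = k
  ; adj = λ i j → (r i j ∨ r j i) ∧ not ⌊ i ≟ j ⌋
  ; adj-sym = λ i j → cong₂ (λ a b → a ∧ not b) (∨-comm (r i j) (r j i)) (≟-sym i j)
  ; adj-irrefl = λ i → Relation.Binary.PropositionalEquality.trans
                     (Relation.Binary.PropositionalEquality.cong (λ b → (r i i ∨ r i i) ∧ not b) (≟-refl i))
                     (BP.∧-zeroʳ (r i i ∨ r i i))
  }

cycle : ℕ → Graph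
cycle k = fromRel k (λ i j → (suc (toℕ i) ≡ᵇ toℕ j) ∨ ((suc (toℕ i) ≡ᵇ k) ∧ (toℕ j ≡ᵇ 0)))

emptyGraph : Graph
emptyGraph = fromRel 0 (λ ())

_⊕_ : Graph → Graph → Graph
G ⊕ H = fromRel (n G + n H) r
  where
  r : Fin (n G + n H) → Fin (n G + n H) → Bool
  r x y with splitAt (n G) x | splitAt (n G) y
  ... | inj₁ a | inj₁ b = adj G a b
  ... | inj₂ a | inj₂ b = adj H a b
  ... | _      | _      = false

unionOfCycles : ∀ {len} → Vec ℕ len → Graph
unionOfCycles []       = emptyGraph
unionOfCycles (k ∷ ks) = cycle k ⊕ unionOfCycles ks

K1∨ : Graph → Graph
K1∨ G = fromRel (suc (n G)) r
  where
  r : Fin (suc (n G)) → Fin (suc (n G)) → Bool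
  r zero    (suc _) = true
  r (suc i) (suc j) = adj G i j
  r _       _       = false

allVecs : ∀ {A : Set} → List A → (k : ℕ) → List (Vec A k)
allVecs xs zero    = [ [] ]
allVecs xs (suc k) = concatMap (λ x → map (x ∷_) (allVecs xs k)) xs

allFinList : (m : ℕ) → List (Fin m)
allFinList zero    = []
allFinList (suc m) = zero ∷ map suc (allFinList m)

ProperColoring : (G : Graph) {m : ℕ} → (Fin (n G) → Fin m) → Set
ProperColoring G c = ∀ u w → Edge G u w → c u ≢ c w

properVec? : (G : Graph) {m : ℕ} (c : Vec (Fin m) (n G)) → Dec (ProperColoring G (lookup c))
properVec? G c = all? λ u → all? λ w →
  (adj G u w Data.Bool.≟ true) →-dec ¬? (lookup c u ≟ lookup c w)
  where import Data.Bool

chromPoly : Graph → ℕ → ℕ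
chromPoly G m = length (filter (properVec? G) (allVecs (allFinList m) (n G)))

Colorable : Graph → ℕ → Set
Colorable G N = Σ (Fin (n G) → Fin N) (ProperColoring G)

record Cover (G : Graph) (m : ℕ) : Set where
  field
    H : Graph
    L : Fin (n G) → Subset (n H)
    covering : ∀ x → ∃ λ u → x ∈ L u
    disjoint : ∀ x u w → x ∈ L u → x ∈ L w → u ≡ w
    size     : ∀ u → ∣ L u ∣ ≡ m
    clique   : ∀ u x y → x ∈ L u → y ∈ L u → x ≢ y → Edge H x y
    cross    : ∀ u w x y → u ≢ w → x ∈ L u → y ∈ L w → Edge H x y → Edge G u w
    -- (4) edges between L(u), L(w) form a matching (each x ∈ L(u) has at
    --     most one neighbour in L(w); the other side follows by swapping u,w)
    matching : ∀ u w x y y′ → u ≢ w → x ∈ L u → y ∈ L w → y′ ∈ L w →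
               Edge H x y → Edge H x y′ → y ≡ y′

open Cover public

IsHColoring : {G : Graph} {m : ℕ} → (𝓗 : Cover G m) → Subset (n (H 𝓗)) → Set
IsHColoring {G} 𝓗 I =
  (∣ I ∣ ≡ n G) × (∀ x y → x ∈ I → y ∈ I → adj (H 𝓗) x y ≡ false)

isHColoring? : {G : Graph} {m : ℕ} (𝓗 : Cover G m) (I : Subset (n (H 𝓗))) → Dec (IsHColoring 𝓗 I)
isHColoring? {G} 𝓗 I =
  (∣ I ∣ ℕP.≟ n G) ×-dec
  (all? λ x → all? λ y → (x ∈? I) →-dec ((y ∈? I) →-dec (adj (H 𝓗) x y Data.Bool.≟ false)))
  where import Data.Bool

numHColorings : {G : Graph} {m : ℕ} → Cover G m → ℕ
numHColorings 𝓗 = length (filter (isHColoring? 𝓗) (allVecs (true ∷ false ∷ []) (n (H 𝓗))))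

IsPDP : Graph → ℕ → ℕ → Set
IsPDP G m k = (Σ (Cover G m) λ 𝓗 → numHColorings 𝓗 ≡ k)
            × (∀ (𝓗 : Cover G m) → k ≤ numHColorings 𝓗)

PDP≡P : Graph → ℕ → Set
PDP≡P G m = IsPDP G m (chromPoly G m)

τDP≤ : Graph → ℕ → Set
τDP≤ G b = Σ ℕ λ N → (N ≤ b) × Colorable G N × (∀ m → N ≤ m → PDP≡P G m)

{-# OPTIONS --safe #-}
module Submission where

-- For a colour x of the hub let Nᵢ(x) be the number of ways to colour the i-th
-- cycle once x is chosen, so that a cover has at least Σₓ Πᵢ Nᵢ(x) colourings.
-- By AM-GM it suffices to show Πₓ Nᵢ(x) ≥ P(Cₖ, m - 1) ^ m for each cycle
-- separately.  Matchings extend to permutations, and we may label all lists so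
-- that the hub matchings are the identity.  Walk counting on a cycle with
-- permutation matchings gives (m - 1) C(k) ± fix(π), where π is the product of
-- the permutations and C depends only on k and m; this settles odd k.  For even k let d be the number of
-- colours moved by some permutation and c = C(k - 1), so P(Cₖ, m - 1) is
-- (m - 1)(m - 2) c.  An unmoved colour x loses at most d, but for a moved
-- colour the deletion of x leaves a matching that is not perfect, and the
-- walks through the missing edge give Nᵢ(x) ≥ P + c - d; Bernoulli's
-- inequality and c > m (this is where m ≥ 5 enters) conclude.

open import Defs
open import Data.Nat hiding (_≟_)
open import Data.Nat.Properties hiding (_≟_; suc-injective; 0≢1+n)
open import Data.Nat.Tactic.RingSolver using (solve-∀)
open import Data.Bool using (Bool; true; false; if_then_else_; not; _∨_; _∧_)
import Data.Bool as Bool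
open import Data.Bool.Properties using (not-injective; ∨-idem; ∧-identityʳ; ∧-zeroʳ; T-≡; ∨-zeroʳ; ¬-not)
open import Data.Fin using (Fin; zero; suc; toℕ; _≟_; punchIn; punchOut; _↑ˡ_; _↑ʳ_; splitAt; combine; remQuot)
open import Data.Fin.Properties using (any?; all?; injective⇒≤; suc-injective; 0≢1+n; toℕ-injective; toℕ<n; punchIn-injective; punchInᵢ≢i; punchIn-punchOut; punchOut-injective; ¬∀⟶∃¬; splitAt-↑ˡ; splitAt-↑ʳ; join-splitAt; ↑ˡ-injective; ↑ʳ-injective; remQuot-combine; combine-remQuot; combine-injective)
open import Data.Fin.Subset using (Subset; inside; outside; ∣_∣) renaming (_∈_ to _∈ₛ_)
open import Data.Fin.Subset.Properties using (⊆-antisym)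
open import Data.List as List using (List; []; _∷_; filter; length; concatMap; cartesianProductWith; _++_)
open import Data.List.Properties using (length-++; length-map; filter-++; map-∘; map-id; length-tabulate)
open import Data.List.Membership.Propositional using (_∈_)
open import Data.List.Membership.Propositional.Properties using (∈-∃++; ∈-++⁻; ∈-++⁺ˡ; ∈-++⁺ʳ; ∈-map⁺; ∈-map⁻; ∈-filter⁺; ∈-filter⁻; ∈-cartesianProductWith⁺; ∈-tabulate⁺)
open import Data.List.Relation.Unary.Any using (here; there)
open import Data.List.Relation.Unary.All as ListAll using ()
open import Data.List.Relation.Unary.AllPairs using ([]; _∷_)
open import Data.List.Relation.Unary.Unique.Propositional using (Unique)
import Data.List.Relation.Unary.Unique.Propositional.Properties as Unique
open import Data.Vec as Vec using (Vec; []; _∷_; lookup; _∷ʳ_; tabulate; here; there)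
open import Data.Vec.Properties using (lookup-++ˡ; lookup-++ʳ; lookup-map; map-∷ʳ; tabulate∘lookup; tabulate-∘; tabulate-cong; lookup∘tabulate; lookup⇒[]=; []=⇒lookup; ∷-injective)
open import Data.Vec.Relation.Unary.All using (All; []; _∷_)
open import Data.Product using (_×_; _,_; ∃; proj₁; proj₂)
open import Data.Sum using (_⊎_; inj₁; inj₂)
open import Function using (_∘_; id; Equivalence)
open import Function.Definitions using (Injective)
open import Relation.Binary.PropositionalEquality
open import Relation.Nullary using (Dec; yes; no; does; ¬_; ¬?; contradiction; _→-dec_)
open import Relation.Nullary.Decidable using (dec-true; dec-false; ⌊_⌋)
open import Relation.Unary using (Decidable)

open import Algebra.Properties.Semiring.Sum +-*-semiring
  using (sum; sum-cong-≗; sum-replicate-zero; ∑-distrib-+; ∑-comm; sum-remove; *-distribˡ-sum; *-distribʳ-sum)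
open import Algebra.Properties.CommutativeMonoid.Sum *-1-commutativeMonoid
  using () renaming (sum to prod; ∑-distrib-+ to ∏-distrib-*)

-- Sums, products and inequalities

-- Products are used because the cycles interact only through the hub colour: Πₓ Πᵢ Nᵢ(x) = Πᵢ Πₓ
-- Nᵢ(x) separates them, while Σₓ Πᵢ Nᵢ(x) does not, and AM-GM is sharp at the cover with identity
-- matchings, where all Nᵢ(x) agree in x. For even k a bound for each x alone is impossible: an
-- unmoved x can have fewer than P(Cₖ, m - 1) colourings, and only the moved colours make up for it.
-- Fixed points of π enter with the sign (-1)^k, so the identity is the worst case for odd k and the
-- best one for even k. Matchings are completed to permutations at two levels. On all m colours this
-- ensures that a moved x has a preimage other than x, which loses its partner when x is deleted. On
-- the m - 1 remaining colours it makes the walk formula available, and the walks destroyed by the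
-- new edge at that preimage can be counted and added back. Completion only adds conflicts, so lower
-- bounds survive it. Throughout, m = 3 + y, so that 2 + y colours remain beside the hub colour and
-- m ≥ 5 reads 2 ≤ y.

sum-mono : ∀ {n} {f g : Fin n → ℕ} → (∀ i → f i ≤ g i) → sum f ≤ sum g
sum-mono {zero}  h = z≤n
sum-mono {suc n} h = +-mono-≤ (h zero) (sum-mono (h ∘ suc))

prod-mono : ∀ {n} {f g : Fin n → ℕ} → (∀ i → f i ≤ g i) → prod f ≤ prod g
prod-mono {zero}  h = ≤-refl
prod-mono {suc n} h = *-mono-≤ (h zero) (prod-mono (h ∘ suc))

sum-const : ∀ n c → sum {n} (λ _ → c) ≡ n * c
sum-const zero    c = refl
sum-const (suc n) c = cong (c +_) (sum-const n c)

prod-const : ∀ n c → prod {n} (λ _ → c) ≡ c ^ n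
prod-const zero    c = refl
prod-const (suc n) c = cong (c *_) (prod-const n c)

2ty≤t²+y² : ∀ t y → 2 * (t * y) ≤ t * t + y * y
2ty≤t²+y² t y with ≤-total t y
... | inj₁ t≤y with o , refl ← m≤n⇒∃[o]m+o≡n t≤y =
  subst (2 * (t * (t + o)) ≤_) (lemma t o) (m≤m+n _ (o * o))
  where
  lemma : ∀ t o → 2 * (t * (t + o)) + o * o ≡ t * t + (t + o) * (t + o)
  lemma = solve-∀
... | inj₂ y≤t with o , refl ← m≤n⇒∃[o]m+o≡n y≤t =
  subst (2 * ((y + o) * y) ≤_) (lemma y o) (m≤m+n _ (o * o))
  where
  lemma : ∀ y o → 2 * ((y + o) * y) + o * o ≡ (y + o) * (y + o) + y * y
  lemma = solve-∀

-- The tangent line bound for t^(n+1) at y, free of subtraction. Once n t y^(n+1) is added to both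
-- sides, 2ty ≤ t² + y² leaves t times the previous case.
young : ∀ n t y → suc n * (t * y ^ n) ≤ t ^ suc n + n * y ^ suc n
young zero    t y = ≤-reflexive (lemma t)
  where
  lemma : ∀ t → 1 * (t * 1) ≡ t * 1 + 0
  lemma = solve-∀
young (suc n) t y = +-cancelʳ-≤ (n * (t * (y * B))) _ _ (begin
  suc (suc n) * (t * (y * B)) + n * (t * (y * B))         ≡⟨ l₁ n t y B ⟩
  suc n * B * (2 * (t * y))                               ≤⟨ *-monoʳ-≤ (suc n * B) (2ty≤t²+y² t y) ⟩
  suc n * B * (t * t + y * y)                             ≡⟨ l₂ n t y B ⟩
  t * (suc n * (t * B)) + suc n * (y * (y * B))           ≤⟨ +-monoˡ-≤ _ (*-monoʳ-≤ t (young n t y)) ⟩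
  t * (A + n * (y * B)) + suc n * (y * (y * B))           ≡⟨ l₃ n t y A B ⟩
  t * A + suc n * (y * (y * B)) + n * (t * (y * B))       ∎)
  where
  open ≤-Reasoning
  A = t ^ suc n
  B = y ^ n
  l₁ : ∀ n t y B → suc (suc n) * (t * (y * B)) + n * (t * (y * B)) ≡ suc n * B * (2 * (t * y))
  l₁ = solve-∀
  l₂ : ∀ n t y B → suc n * B * (t * t + y * y) ≡ t * (suc n * (t * B)) + suc n * (y * (y * B))
  l₂ = solve-∀
  l₃ : ∀ n t y A B → t * (A + n * (y * B)) + suc n * (y * (y * B))
                   ≡ t * A + suc n * (y * (y * B)) + n * (t * (y * B))
  l₃ = solve-∀

^-distribʳ-* : ∀ n x y → (x * y) ^ n ≡ x ^ n * y ^ n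
^-distribʳ-* zero    x y = refl
^-distribʳ-* (suc n) x y = trans (cong (x * y *_) (^-distribʳ-* n x y)) (lemma x y (x ^ n) (y ^ n))
  where
  lemma : ∀ x y a b → x * y * (a * b) ≡ x * a * (y * b)
  lemma = solve-∀

amgm-step : ∀ n s b .{{_ : NonZero n}} →
            suc n ^ suc n * (b * s ^ n) ≤ n ^ n * (s + b) ^ suc n
amgm-step n s b = *-cancelˡ-≤ n (begin
  n * (suc n ^ suc n * (b * s ^ n))   ≡⟨ l₁ n (suc n ^ n) b (s ^ n) ⟩
  suc n * (n * b) * (suc n ^ n * s ^ n) ≡⟨ cong (suc n * (n * b) *_) (^-distribʳ-* n (suc n) s) ⟨
  suc n * (n * b) * Y ^ n             ≤⟨ +-cancelʳ-≤ (n * Y ^ suc n) _ _ main ⟩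
  T ^ suc n                           ≡⟨ cong (_^ suc n) (*-distribˡ-+ n s b) ⟨
  (n * (s + b)) ^ suc n               ≡⟨ ^-distribʳ-* (suc n) n (s + b) ⟩
  n * n ^ n * (s + b) ^ suc n         ≡⟨ *-assoc n (n ^ n) _ ⟩
  n * (n ^ n * (s + b) ^ suc n)       ∎)
  where
  open ≤-Reasoning
  -- With tangent point `Y` and argument `T` = n (s + b) the terms in s cancel: (n + 1) T - n Y = n
  -- (n + 1) b.
  Y = suc n * s
  T = n * s + n * b
  l₁ : ∀ n e b f → n * (suc n * e * (b * f)) ≡ suc n * (n * b) * (e * f)
  l₁ = solve-∀
  l₂ : ∀ n s b z → suc n * (n * b) * z + n * (suc n * s * z) ≡ suc n * ((n * s + n * b) * z)
  l₂ = solve-∀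
  main : suc n * (n * b) * Y ^ n + n * Y ^ suc n ≤ T ^ suc n + n * Y ^ suc n
  main = ≤-trans (≤-reflexive (l₂ n s b (Y ^ n))) (young n T Y)

amgm : ∀ n (a : Fin n → ℕ) → n ^ n * prod a ≤ sum a ^ n
amgm zero            a = ≤-refl
amgm (suc zero)      a = ≤-reflexive (lemma (a zero))
  where
  lemma : ∀ b → 1 * (b * 1) ≡ (b + 0) * 1
  lemma = solve-∀
amgm (suc n@(suc _)) a = *-cancelˡ-≤ (n ^ n) (begin
  n ^ n * (suc n ^ suc n * (b * Π))   ≡⟨ l (n ^ n) (suc n ^ suc n) b Π ⟩
  suc n ^ suc n * (b * (n ^ n * Π))   ≤⟨ *-monoʳ-≤ (suc n ^ suc n) (*-monoʳ-≤ b (amgm n (a ∘ suc))) ⟩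
  suc n ^ suc n * (b * s ^ n)         ≤⟨ amgm-step n s b ⟩
  n ^ n * (s + b) ^ suc n             ≡⟨ cong (λ w → n ^ n * w ^ suc n) (+-comm s b) ⟩
  n ^ n * (b + s) ^ suc n             ∎)
  where
  open ≤-Reasoning
  b = a zero
  s = sum (a ∘ suc)
  Π = prod (a ∘ suc)
  instance
    _ : NonZero (n ^ n)
    _ = m^n≢0 n n
  l : ∀ x y b p → x * (y * (b * p)) ≡ y * (b * (x * p))
  l = solve-∀

-- Comparing n-th powers avoids roots: a sum below n p would have an n-th power strictly below (n
-- p)^n, against `amgm`.
amgm-bound : ∀ n (a : Fin n → ℕ) p → p ^ n ≤ prod a → n * p ≤ sum a
amgm-bound zero      a p h = z≤n
amgm-bound n@(suc _) a p h = ≮⇒≥ λ S<np → <⇒≱ (^-monoˡ-< n S<np) (begin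
  (n * p) ^ n     ≡⟨ ^-distribʳ-* n n p ⟩
  n ^ n * p ^ n   ≤⟨ *-monoʳ-≤ (n ^ n) h ⟩
  n ^ n * prod a  ≤⟨ amgm n a ⟩
  sum a ^ n       ∎)
  where open ≤-Reasoning

-- Bernoulli's (1 + e/y)^n ≥ 1 + n e/y, multiplied by y^(n+1).
bernoulli-up : ∀ n y e → y ^ n * (y + n * e) ≤ y * (y + e) ^ n
bernoulli-up zero    y e = ≤-reflexive (lemma y)
  where
  lemma : ∀ y → 1 * (y + 0) ≡ y * 1
  lemma = solve-∀
bernoulli-up (suc n) y e = begin
  y * y ^ n * (y + suc n * e)                      ≤⟨ m≤m+n _ _ ⟩
  y * y ^ n * (y + suc n * e) + y ^ n * n * e * e  ≡⟨ l₁ y (y ^ n) n e ⟩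
  (y + e) * (y ^ n * (y + n * e))                  ≤⟨ *-monoʳ-≤ (y + e) (bernoulli-up n y e) ⟩
  (y + e) * (y * (y + e) ^ n)                      ≡⟨ l₂ y (y + e) ((y + e) ^ n) ⟩
  y * ((y + e) * (y + e) ^ n)                      ∎
  where
  open ≤-Reasoning
  l₁ : ∀ y z n e → y * z * (y + suc n * e) + z * n * e * e ≡ (y + e) * (z * (y + n * e))
  l₁ = solve-∀
  l₂ : ∀ y f z → f * (y * z) ≡ y * (f * z)
  l₂ = solve-∀

-- Bernoulli's (1 - d/P)^n ≥ 1 - n d/P for P = u + d, multiplied by P^(n+1) and with the negative
-- term moved across.
bernoulli-down : ∀ n u d → (u + d) ^ n * (u + d) ≤ (u + d) * u ^ n + n * d * (u + d) ^ n
bernoulli-down zero    u d = ≤-reflexive (lemma (u + d))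
  where
  lemma : ∀ y → 1 * y ≡ y * 1 + 0
  lemma = solve-∀
bernoulli-down (suc n) u d = begin
  (u + d) * z * (u + d)                                     ≡⟨ l₁ u d z ⟩
  u * (z * (u + d)) + d * (u + d) * z                       ≤⟨ +-monoˡ-≤ _ (*-monoʳ-≤ u (bernoulli-down n u d)) ⟩
  u * ((u + d) * u ^ n + n * d * z) + d * (u + d) * z       ≤⟨ m≤m+n _ (n * d * d * z) ⟩
  u * ((u + d) * u ^ n + n * d * z) + d * (u + d) * z + n * d * d * z ≡⟨ l₂ u d z n (u ^ n) ⟩
  (u + d) * (u * u ^ n) + suc n * d * ((u + d) * z)         ∎
  where
  open ≤-Reasoning
  z = (u + d) ^ n
  l₁ : ∀ u d z → (u + d) * z * (u + d) ≡ u * (z * (u + d)) + d * (u + d) * z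
  l₁ = solve-∀
  l₂ : ∀ u d z n w → u * ((u + d) * w + n * d * z) + d * (u + d) * z + n * d * d * z
                   ≡ (u + d) * (u * w) + suc n * d * ((u + d) * z)
  l₂ = solve-∀

-- The loss d on s factors is outweighed by the gain e on d factors.
power-trade : ∀ s d e u w → suc s ≤ e → s * s * d ≤ w → u + d ≡ w + s * d → 0 < u + d →
              (u + d) ^ (s + d) ≤ u ^ s * (u + d + e) ^ d
power-trade s d e u w s<e ssd≤w eq pos = *-cancelˡ-≤ (P * P) (+-cancelʳ-≤ (P ^ d * (P + d * e) * (s * d * P ^ s)) _ _ (begin
  P * P * P ^ (s + d) + P ^ d * (P + d * e) * (s * d * P ^ s)
    ≡⟨ cong (λ t → P * P * t + P ^ d * (P + d * e) * (s * d * P ^ s)) (^-distribˡ-+-* P s d) ⟩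
  P * P * (P ^ s * P ^ d) + P ^ d * (P + d * e) * (s * d * P ^ s)
    ≡⟨ l₁ P (P ^ s) (P ^ d) (d * e) (s * d) ⟩
  P ^ s * P ^ d * (P * P + (P + d * e) * (s * d))
    ≤⟨ *-monoʳ-≤ (P ^ s * P ^ d) quad ⟩
  P ^ s * P ^ d * ((P + d * e) * P)
    ≡⟨ l₂ P (P ^ s) (P ^ d) (P + d * e) ⟩
  P ^ d * (P + d * e) * (P ^ s * P)
    ≤⟨ *-monoʳ-≤ (P ^ d * (P + d * e)) (bernoulli-down s u d) ⟩
  P ^ d * (P + d * e) * (P * u ^ s + s * d * P ^ s)
    ≡⟨ *-distribˡ-+ (P ^ d * (P + d * e)) _ _ ⟩
  P ^ d * (P + d * e) * (P * u ^ s) + P ^ d * (P + d * e) * (s * d * P ^ s)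
    ≤⟨ +-monoˡ-≤ _ (*-monoˡ-≤ (P * u ^ s) (bernoulli-up d P e)) ⟩
  P * (P + e) ^ d * (P * u ^ s) + P ^ d * (P + d * e) * (s * d * P ^ s)
    ≡⟨ cong (_+ P ^ d * (P + d * e) * (s * d * P ^ s)) (l₃ P ((P + e) ^ d) (u ^ s)) ⟩
  P * P * (u ^ s * (P + e) ^ d) + P ^ d * (P + d * e) * (s * d * P ^ s) ∎))
  where
  open ≤-Reasoning
  P = u + d
  instance
    _ : NonZero (P * P)
    _ = >-nonZero (*-mono-≤ pos pos)
  l₁ : ∀ P a b x y → P * P * (a * b) + b * (P + x) * (y * a) ≡ a * b * (P * P + (P + x) * y)
  l₁ = solve-∀
  l₂ : ∀ P a b x → a * b * (x * P) ≡ b * x * (a * P)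
  l₂ = solve-∀
  l₃ : ∀ P v x → P * v * (P * x) ≡ P * P * (x * v)
  l₃ = solve-∀
  l₄ : ∀ w s d → (w + s * d) * (s * d) ≡ d * s * w + d * (s * s * d)
  l₄ = solve-∀
  l₅ : ∀ w s d → d * s * w + d * w ≡ suc s * (d * w)
  l₅ = solve-∀
  l₆ : ∀ P x y → P * P + (P + x) * y ≡ P * P + P * y + x * y
  l₆ = solve-∀
  l₇ : ∀ P d e w y → P * P + e * (d * w) + d * e * y ≡ P * P + d * e * (w + y)
  l₇ = solve-∀
  -- The two Bernoulli bounds reduce the goal to (1 - sd/P)(1 + de/P) ≥ 1, that is P s d ≤ e d w
  -- with w = P - sd. Since s²d ≤ w, the product P s = w s + s²d is at most (s + 1) w.
  key : P * (s * d) ≤ e * (d * w)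
  key = begin
    P * (s * d)                      ≡⟨ cong (_* (s * d)) eq ⟩
    (w + s * d) * (s * d)            ≡⟨ l₄ w s d ⟩
    d * s * w + d * (s * s * d)      ≤⟨ +-monoʳ-≤ (d * s * w) (*-monoʳ-≤ d ssd≤w) ⟩
    d * s * w + d * w                ≡⟨ l₅ w s d ⟩
    suc s * (d * w)                  ≤⟨ *-monoˡ-≤ (d * w) s<e ⟩
    e * (d * w)                      ∎
  quad : P * P + (P + d * e) * (s * d) ≤ (P + d * e) * P
  quad = begin
    P * P + (P + d * e) * (s * d)              ≡⟨ l₆ P (d * e) (s * d) ⟩
    P * P + P * (s * d) + d * e * (s * d)      ≤⟨ +-monoˡ-≤ _ (+-monoʳ-≤ (P * P) key) ⟩
    P * P + e * (d * w) + d * e * (s * d)      ≡⟨ l₇ P d e w (s * d) ⟩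
    P * P + d * e * (w + s * d)                ≡⟨ cong (λ t → P * P + d * e * t) eq ⟨
    P * P + d * e * P                          ≡⟨ *-distribʳ-+ P P (d * e) ⟨
    (P + d * e) * P                            ∎

𝟙 : Bool → ℕ
𝟙 true  = 1
𝟙 false = 0

sum-𝟙-not : ∀ {n} (g : Fin n → Bool) → sum (𝟙 ∘ g) + sum (𝟙 ∘ not ∘ g) ≡ n
sum-𝟙-not {zero}  g = refl
sum-𝟙-not {suc n} g with g zero
... | true  = cong suc (sum-𝟙-not (g ∘ suc))
... | false = trans (+-suc _ _) (cong suc (sum-𝟙-not (g ∘ suc)))

prod-if : ∀ {n} (g : Fin n → Bool) u v →
          prod (λ i → if g i then u else v) ≡ u ^ sum (𝟙 ∘ g) * v ^ sum (𝟙 ∘ not ∘ g)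
prod-if {zero}  g u v = refl
prod-if {suc n} g u v with g zero
... | true  = trans (cong (u *_) (prod-if (g ∘ suc) u v)) (sym (*-assoc u _ _))
... | false = trans (cong (v *_) (prod-if (g ∘ suc) u v)) (lemma v (u ^ sum (𝟙 ∘ g ∘ suc)) (v ^ sum (𝟙 ∘ not ∘ g ∘ suc)))
  where
  lemma : ∀ v a b → v * (a * b) ≡ a * (v * b)
  lemma = solve-∀

-- The right side is the factor (m - 1)(m - 2) of the chromatic value for m = 2 + z, so s d (s + 1)
-- stays below that value as soon as s + 1 ≤ c.
split-product≤ : ∀ s d {z} → 2 ≤ z → s + d ≡ 2 + z → s * d ≤ suc z * z
split-product≤ zero          d       2≤z eq = z≤n
split-product≤ (suc zero)    d {z}   2≤z eq = begin
  d + 0            ≡⟨ +-identityʳ d ⟩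
  d                ≡⟨ cong pred eq ⟩
  suc z            ≡⟨ *-identityʳ (suc z) ⟨
  suc z * 1        ≤⟨ *-monoʳ-≤ (suc z) (≤-trans (s≤s z≤n) 2≤z) ⟩
  suc z * z        ∎
  where open ≤-Reasoning
split-product≤ (suc (suc s′)) zero    2≤z eq = ≤-trans (≤-reflexive (*-zeroʳ s′)) z≤n
split-product≤ (suc (suc s′)) (suc d) {z} 2≤z eq = *-mono-≤ s≤1+z d≤z
  where
  eq′ : s′ + suc d ≡ z
  eq′ = cong (pred ∘ pred) eq
  d≤z : suc d ≤ z
  d≤z = subst (suc d ≤_) eq′ (m≤n+m _ _)
  s≤1+z : suc (suc s′) ≤ suc z
  s≤1+z = s≤s (subst (suc s′ ≤_) eq′ (≤-trans (m≤m+n (suc s′) d) (≤-reflexive (sym (+-suc s′ d)))))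

-- `g` marks the s unmoved colours, each losing at most d; the d moved ones gain e = c - d each. As
-- s + d = 2 + z, the hypothesis 3 + z ≤ c says exactly that s + 1 ≤ e, the ratio of gain to loss
-- that `power-trade` asks for.
prod-bound : ∀ z c (N : Fin (2 + z) → ℕ) (g : Fin (2 + z) → Bool) →
  2 ≤ z → 3 + z ≤ c →
  (∀ x → g x ≡ true  → suc z * z * c     ≤ N x + sum (𝟙 ∘ not ∘ g)) →
  (∀ x → g x ≡ false → suc z * z * c + c ≤ N x + sum (𝟙 ∘ not ∘ g)) →
  (suc z * z * c) ^ (2 + z) ≤ prod N
prod-bound z c N g 2≤z 3+z≤c good bad = begin
  P ^ (2 + z)                          ≡⟨ cong₂ _^_ (sym u+d) (sym s+d) ⟩
  (u + d) ^ (s + d)                    ≤⟨ power-trade s d e u w s<e (m+n≤o⇒m≤o∸n _ ssd+sd≤P) (trans u+d (sym (m∸n+n≡m sd≤P))) (subst (0 <_) (sym u+d) (≤-trans (s≤s z≤n) (≤-trans 3+z≤c c≤P))) ⟩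
  u ^ s * (u + d + e) ^ d              ≡⟨ prod-if g u (u + d + e) ⟨
  prod (λ x → if g x then u else u + d + e) ≤⟨ prod-mono pointwise ⟩
  prod N                               ∎
  where
  open ≤-Reasoning
  P = suc z * z * c
  s = sum (𝟙 ∘ g)
  d = sum (𝟙 ∘ not ∘ g)
  u = P ∸ d
  e = c ∸ d
  w = P ∸ s * d
  s+d : s + d ≡ 2 + z
  s+d = sum-𝟙-not g
  1+s+d≤c : suc s + d ≤ c
  1+s+d≤c = subst (_≤ c) (cong suc (sym s+d)) 3+z≤c
  d≤c : d ≤ c
  d≤c = ≤-trans (m≤n+m d (suc s)) 1+s+d≤c
  c≤P : c ≤ P
  c≤P = subst (_≤ P) (*-identityˡ c) (*-monoˡ-≤ c (*-mono-≤ (s≤s (z≤n {z})) (≤-trans (s≤s z≤n) 2≤z)))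
  u+d : u + d ≡ P
  u+d = m∸n+n≡m (≤-trans d≤c c≤P)
  e+d : e + d ≡ c
  e+d = m∸n+n≡m d≤c
  s<e : suc s ≤ e
  s<e = m+n≤o⇒m≤o∸n (suc s) 1+s+d≤c
  ssd+sd≤P : s * s * d + s * d ≤ P
  ssd+sd≤P = begin
    s * s * d + s * d   ≡⟨ l s d ⟩
    s * d * suc s       ≤⟨ *-mono-≤ (split-product≤ s d 2≤z s+d) (≤-trans (m≤m+n (suc s) d) 1+s+d≤c) ⟩
    P                   ∎
    where
    l : ∀ s d → s * s * d + s * d ≡ s * d * suc s
    l = solve-∀
  sd≤P : s * d ≤ P
  sd≤P = ≤-trans (m≤n+m _ (s * s * d)) ssd+sd≤P
  pointwise : ∀ x → (if g x then u else u + d + e) ≤ N x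
  pointwise x with g x in eq
  ... | true  = +-cancelʳ-≤ d _ _ (≤-trans (≤-reflexive u+d) (good x eq))
  ... | false = +-cancelʳ-≤ d _ _ (≤-trans (≤-reflexive (trans (+-assoc (u + d) e d) (cong₂ _+_ u+d e+d))) (bad x eq))

-- Matchings and walks

Inj : ∀ {a b} → (Fin a → Fin b) → Set
Inj f = Injective _≡_ _≡_ f

does⇒ : ∀ {A : Set} (d : Dec A) → does d ≡ true → A
does⇒ (yes p) _ = p

missed-value : ∀ {a b} (g : Fin a → Fin b) → a < b → ∃ λ j → ∀ i → g i ≢ j
missed-value g a<b with any? (λ j → all? (λ i → ¬? (g i ≟ j)))
... | yes p = p
... | no ¬p = contradiction (injective⇒≤ h-inj) (<⇒≱ a<b)
  where
  pre : ∀ j → ∃ λ i → g i ≡ j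
  pre j with any? (λ i → g i ≟ j)
  ... | yes p = p
  ... | no ¬q = contradiction (j , λ i e → ¬q (i , e)) ¬p
  h-inj : Inj (proj₁ ∘ pre)
  h-inj {j} {j′} eq = trans (sym (proj₂ (pre j))) (trans (cong g eq) (proj₂ (pre j′)))

inj⇒surj : ∀ {n} {f : Fin n → Fin n} → Inj f → ∀ b → ∃ λ a → f a ≡ b
inj⇒surj {suc n} {f} inj b with any? (λ a → f a ≟ b)
... | yes p = p
... | no ¬p = contradiction (injective⇒≤ h-inj) 1+n≰n
  where
  b≢f : ∀ a → b ≢ f a
  b≢f a e = ¬p (a , sym e)
  h-inj : Inj (λ a → punchOut (b≢f a))
  h-inj eq = inj (punchOut-injective (b≢f _) (b≢f _) eq)

-- Induction on the left side. A matched first element takes its partner out of the right side; an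
-- unmatched one waits until the others are placed and receives a value they miss. This second case
-- shrinks only the left side, hence a ≤ b instead of a = b.
extend-matching : ∀ {a b} (r : Fin a → Fin b → Bool) → a ≤ b →
  (∀ i j j′ → r i j ≡ true → r i j′ ≡ true → j ≡ j′) →
  (∀ i i′ j → r i j ≡ true → r i′ j ≡ true → i ≡ i′) →
  ∃ λ f → Inj f × (∀ i j → r i j ≡ true → f i ≡ j)
extend-matching {zero}  r a≤b row col = (λ ()) , (λ { {()} }) , (λ ())
extend-matching {suc a} {suc b} r (s≤s a≤b) row col with any? (λ j → r zero j Bool.≟ true)
... | yes (j₀ , p) = f , f-inj , f-ext
  where
  rec = extend-matching (λ i j → r (suc i) (punchIn j₀ j)) a≤b
          (λ i j j′ x y → punchIn-injective j₀ j j′ (row _ _ _ x y))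
          (λ i i′ j x y → suc-injective (col _ _ _ x y))
  f : Fin (suc a) → Fin (suc b)
  f zero    = j₀
  f (suc i) = punchIn j₀ (proj₁ rec i)
  f-inj : Inj f
  f-inj {zero}  {zero}  eq = refl
  f-inj {zero}  {suc j} eq = contradiction (sym eq) (punchInᵢ≢i j₀ _)
  f-inj {suc i} {zero}  eq = contradiction eq (punchInᵢ≢i j₀ _)
  f-inj {suc i} {suc j} eq = cong suc (proj₁ (proj₂ rec) (punchIn-injective j₀ _ _ eq))
  f-ext : ∀ i j → r i j ≡ true → f i ≡ j
  f-ext zero    j x = row zero j₀ j p x
  f-ext (suc i) j x = trans (cong (punchIn j₀) (proj₂ (proj₂ rec) i (punchOut j₀≢j) (trans (cong (r (suc i)) (punchIn-punchOut j₀≢j)) x))) (punchIn-punchOut j₀≢j)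
    where
    j₀≢j : j₀ ≢ j
    j₀≢j refl = 0≢1+n (col _ _ _ p x)
... | no ¬p = f , f-inj , f-ext
  where
  rec = extend-matching (r ∘ suc) (m≤n⇒m≤1+n a≤b) (λ i → row (suc i)) (λ i i′ j x y → suc-injective (col _ _ _ x y))
  g = proj₁ rec
  miss = missed-value g (s≤s a≤b)
  f : Fin (suc a) → Fin (suc b)
  f zero    = proj₁ miss
  f (suc i) = g i
  f-inj : Inj f
  f-inj {zero}  {zero}  eq = refl
  f-inj {zero}  {suc j} eq = contradiction (sym eq) (proj₂ miss j)
  f-inj {suc i} {zero}  eq = contradiction eq (proj₂ miss i)
  f-inj {suc i} {suc j} eq = cong suc (proj₁ (proj₂ rec) eq)
  f-ext : ∀ i j → r i j ≡ true → f i ≡ j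
  f-ext zero    j x = contradiction (j , x) ¬p
  f-ext (suc i) j x = proj₂ (proj₂ rec) i j x

δ : ∀ {q} → Fin q → Fin q → ℕ
δ a b = 𝟙 (does (a ≟ b))

δ-refl : ∀ {q} {a b : Fin q} → a ≡ b → δ a b ≡ 1
δ-refl {a = a} {b} eq = cong 𝟙 (dec-true (a ≟ b) eq)

δ-≢ : ∀ {q} {a b : Fin q} → a ≢ b → δ a b ≡ 0
δ-≢ {a = a} {b} ne = cong 𝟙 (dec-false (a ≟ b) ne)

𝟙≤1 : ∀ b → 𝟙 b ≤ 1
𝟙≤1 true  = ≤-refl
𝟙≤1 false = z≤n

𝟙-not : ∀ b → 𝟙 (not b) + 𝟙 b ≡ 1
𝟙-not true  = refl
𝟙-not false = refl

sum-δ : ∀ {q} (a : Fin q) (h : Fin q → ℕ) → sum (λ c → δ a c * h c) ≡ h a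
sum-δ {suc q} a h = begin
  sum (λ c → δ a c * h c)                               ≡⟨ sum-remove {i = a} (λ c → δ a c * h c) ⟩
  δ a a * h a + sum (λ c → δ a (punchIn a c) * h (punchIn a c))
    ≡⟨ cong₂ _+_ (trans (cong (_* h a) (δ-refl {a = a} refl)) (*-identityˡ (h a)))
                 (sum-cong-≗ (λ c → cong (_* h (punchIn a c)) (δ-≢ (punchInᵢ≢i a c ∘ sym)))) ⟩
  h a + sum {q} (λ _ → 0)                               ≡⟨ cong (h a +_) (sum-replicate-zero q) ⟩
  h a + 0                                               ≡⟨ +-identityʳ (h a) ⟩
  h a                                                   ∎
  where open ≡-Reasoning

δ-sym : ∀ {q} (a b : Fin q) → δ a b ≡ δ b a
δ-sym a b with a ≟ b
... | yes refl = sym (δ-refl {a = a} refl)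
... | no ne    = sym (δ-≢ (ne ∘ sym))

-- Walks as products of step matrices

module _ {J : Set} {q : ℕ} where

  Conflict : Set
  Conflict = J → Fin q → Fin q → Bool

  _⊑_ : Conflict → Conflict → Set
  r ⊑ s = ∀ j a b → r j a b ≡ true → s j a b ≡ true

  -- The (a, b) entry of the product, along `js`, of the 0-1 matrices of permitted steps, where `r`
  -- lists the forbidden ones. `closed` is the trace of this product.
  walk : Conflict → List J → Fin q → Fin q → ℕ
  walk r []       a b = δ a b
  walk r (j ∷ js) a b = sum λ c → 𝟙 (not (r j a c)) * walk r js c b

  closed : Conflict → List J → ℕ
  closed r js = sum λ a → walk r js a a

  𝟙-not-anti : ∀ {b c} → (b ≡ true → c ≡ true) → 𝟙 (not c) ≤ 𝟙 (not b)
  𝟙-not-anti {false} {c} h = 𝟙≤1 (not c)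
  𝟙-not-anti {true}  {c} h rewrite h refl = z≤n

  walk-anti : ∀ {r s} → r ⊑ s → ∀ js a b → walk s js a b ≤ walk r js a b
  walk-anti h []       a b = ≤-refl
  walk-anti h (j ∷ js) a b =
    sum-mono λ c → *-mono-≤ (𝟙-not-anti (h j a c)) (walk-anti h js c b)

  closed-anti : ∀ {r s} → r ⊑ s → ∀ js → closed s js ≤ closed r js
  closed-anti h js = sum-mono λ a → walk-anti h js a a

  walk-++ : ∀ r is js a b → walk r (is ++ js) a b ≡ sum λ c → walk r is a c * walk r js c b
  walk-++ r []       js a b = sym (sum-δ a (λ c → walk r js c b))
  walk-++ r (i ∷ is) js a b = begin
    sum (λ d → ρ d * walk r (is ++ js) d b)
      ≡⟨ sum-cong-≗ (λ d → cong (ρ d *_) (walk-++ r is js d b)) ⟩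
    sum (λ d → ρ d * sum (λ c → walk r is d c * walk r js c b))
      ≡⟨ sum-cong-≗ (λ d → *-distribˡ-sum (ρ d) (λ c → walk r is d c * walk r js c b)) ⟩
    sum (λ d → sum (λ c → ρ d * (walk r is d c * walk r js c b)))
      ≡⟨ ∑-comm (λ d c → ρ d * (walk r is d c * walk r js c b)) ⟩
    sum (λ c → sum (λ d → ρ d * (walk r is d c * walk r js c b)))
      ≡⟨ sum-cong-≗ (λ c → sum-cong-≗ (λ d → sym (*-assoc (ρ d) (walk r is d c) (walk r js c b)))) ⟩
    sum (λ c → sum (λ d → ρ d * walk r is d c * walk r js c b))
      ≡⟨ sum-cong-≗ (λ c → sym (*-distribʳ-sum (walk r js c b) (λ d → ρ d * walk r is d c))) ⟩
    sum (λ c → walk r (i ∷ is) a c * walk r js c b) ∎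
    where
    open ≡-Reasoning
    ρ = λ d → 𝟙 (not (r i a d))

  -- The extra closed walks are those that use the step a₀ → b₀ at position j.
  closed-extra : ∀ {r s} → r ⊑ s → ∀ pre j suf {a₀ b₀} → r j a₀ b₀ ≡ false → s j a₀ b₀ ≡ true →
    closed s (pre ++ j ∷ suf) + walk s (suf ++ pre) b₀ a₀ ≤ closed r (pre ++ j ∷ suf)
  closed-extra {r} {s} r⊑s pre j suf {a₀} {b₀} rj sj = begin
    closed s (pre ++ j ∷ suf) + walk s (suf ++ pre) b₀ a₀
      ≡⟨ cong (closed s (pre ++ j ∷ suf) +_) (walk-++ s suf pre b₀ a₀) ⟩
    closed s (pre ++ j ∷ suf) + sum (λ a → walk s suf b₀ a * walk s pre a a₀)
      ≡⟨ ∑-distrib-+ _ (λ a → walk s suf b₀ a * walk s pre a a₀) ⟨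
    sum (λ a → walk s (pre ++ j ∷ suf) a a + walk s suf b₀ a * walk s pre a a₀)
      ≤⟨ sum-mono at ⟩
    closed r (pre ++ j ∷ suf) ∎
    where
    open ≤-Reasoning
    -- Entrywise, the permitted steps of `s` plus the matrix unit at (a₀, b₀) stay below those of
    -- `r`. `row` multiplies by the walks along `suf` on the right, `at` by those along `pre` on the
    -- left; in the trace the unit contributes the walks from b₀ through `suf` and `pre` to a₀.
    step : ∀ c d → 𝟙 (not (s j c d)) + δ a₀ c * δ b₀ d ≤ 𝟙 (not (r j c d))
    step c d with a₀ ≟ c | b₀ ≟ d
    ... | yes refl | yes refl rewrite rj | sj = ≤-refl
    ... | yes refl | no _     = ≤-trans (≤-reflexive (+-identityʳ _)) (𝟙-not-anti (r⊑s j c d))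
    ... | no _     | _        = ≤-trans (≤-reflexive (+-identityʳ _)) (𝟙-not-anti (r⊑s j c d))
    row : ∀ a c → walk s (j ∷ suf) c a + δ a₀ c * walk s suf b₀ a ≤ walk r (j ∷ suf) c a
    row a c = begin
      sum (λ d → 𝟙 (not (s j c d)) * V d) + δ a₀ c * V b₀
        ≡⟨ cong (λ t → sum (λ d → 𝟙 (not (s j c d)) * V d) + δ a₀ c * t) (sum-δ b₀ V) ⟨
      sum (λ d → 𝟙 (not (s j c d)) * V d) + δ a₀ c * sum (λ d → δ b₀ d * V d)
        ≡⟨ cong (sum (λ d → 𝟙 (not (s j c d)) * V d) +_) (*-distribˡ-sum (δ a₀ c) (λ d → δ b₀ d * V d)) ⟩
      sum (λ d → 𝟙 (not (s j c d)) * V d) + sum (λ d → δ a₀ c * (δ b₀ d * V d))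
        ≡⟨ ∑-distrib-+ (λ d → 𝟙 (not (s j c d)) * V d) (λ d → δ a₀ c * (δ b₀ d * V d)) ⟨
      sum (λ d → 𝟙 (not (s j c d)) * V d + δ a₀ c * (δ b₀ d * V d))
        ≡⟨ sum-cong-≗ (λ d → factor (𝟙 (not (s j c d))) (δ a₀ c) (δ b₀ d) (V d)) ⟩
      sum (λ d → (𝟙 (not (s j c d)) + δ a₀ c * δ b₀ d) * V d)
        ≤⟨ sum-mono (λ d → *-mono-≤ (step c d) (walk-anti r⊑s suf d a)) ⟩
      walk r (j ∷ suf) c a ∎
      where
      V = λ d → walk s suf d a
      factor : ∀ x y z v → x * v + y * (z * v) ≡ (x + y * z) * v
      factor = solve-∀
    at : ∀ a → walk s (pre ++ j ∷ suf) a a + walk s suf b₀ a * walk s pre a a₀ ≤ walk r (pre ++ j ∷ suf) a a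
    at a = begin
      walk s (pre ++ j ∷ suf) a a + v * W a₀
        ≡⟨ cong₂ _+_ (walk-++ s pre (j ∷ suf) a a) (trans (*-comm v (W a₀)) (sym (sum-δ a₀ (λ c → W c * v)))) ⟩
      sum (λ c → W c * X c) + sum (λ c → δ a₀ c * (W c * v))
        ≡⟨ ∑-distrib-+ (λ c → W c * X c) (λ c → δ a₀ c * (W c * v)) ⟨
      sum (λ c → W c * X c + δ a₀ c * (W c * v))
        ≡⟨ sum-cong-≗ (λ c → factor (W c) (X c) (δ a₀ c) v) ⟩
      sum (λ c → W c * (X c + δ a₀ c * v))
        ≤⟨ sum-mono (λ c → *-mono-≤ (walk-anti r⊑s pre a c) (row a c)) ⟩
      sum (λ c → walk r pre a c * walk r (j ∷ suf) c a)
        ≡⟨ walk-++ r pre (j ∷ suf) a a ⟨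
      walk r (pre ++ j ∷ suf) a a ∎
      where
      v = walk s suf b₀ a
      W = walk s pre a
      X = λ c → walk s (j ∷ suf) c a
      factor : ∀ w x y v → w * x + y * (w * v) ≡ w * (x + y * v)
      factor = solve-∀

-- Walk counts for permutation matchings

even : ℕ → Bool
even zero    = true
even (suc n) = not (even n)

-- With 2 + y colours and permutation matchings of product π, the number of
-- walks of length j from a to b is C y j + (-1) ^ j [π a = b].
C : ℕ → ℕ → ℕ
C y zero          = 0
C y (suc zero)    = 1
C y (suc (suc j)) = y * suc y ^ j + C y j

-- The same recursion as `walk-step`, without the alternating δ term. With C y 0 = 0 it determines C
-- y j = ((1 + y)^j - (-1)^j) / (2 + y), which the two-step definition reaches without subtraction
-- or division.
C-step : ∀ y j → C y j + C y (suc j) ≡ suc y ^ j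
C-step y zero    = refl
C-step y (suc j) = begin
  C y (suc j) + (y * suc y ^ j + C y j)   ≡⟨ l (C y (suc j)) (y * suc y ^ j) (C y j) ⟩
  C y j + C y (suc j) + y * suc y ^ j     ≡⟨ cong (_+ y * suc y ^ j) (C-step y j) ⟩
  suc y ^ j + y * suc y ^ j               ∎
  where
  open ≡-Reasoning
  l : ∀ a b c → a + (b + c) ≡ c + a + b
  l = solve-∀

C-odd : ∀ y j → even j ≡ false → suc (suc y) * C y j ≡ suc (suc y ^ j)
C-odd y zero          ()
C-odd y (suc zero)    _  = l y
  where
  l : ∀ y → suc (suc y) * 1 ≡ suc (suc y * 1)
  l = solve-∀
C-odd y (suc (suc j)) ev = begin
  suc (suc y) * (y * suc y ^ j + C y j)                       ≡⟨ *-distribˡ-+ (suc (suc y)) (y * suc y ^ j) (C y j) ⟩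
  suc (suc y) * (y * suc y ^ j) + suc (suc y) * C y j         ≡⟨ cong (suc (suc y) * (y * suc y ^ j) +_) (C-odd y j (not-injective (not-injective ev))) ⟩
  suc (suc y) * (y * suc y ^ j) + suc (suc y ^ j)             ≡⟨ l y (suc y ^ j) ⟩
  suc (suc y * (suc y * suc y ^ j))                           ∎
  where
  open ≡-Reasoning
  l : ∀ y z → suc (suc y) * (y * z) + suc z ≡ suc (suc y * (suc y * z))
  l = solve-∀

-- Source of the factorisation (m - 1)(m - 2) c: at the next, even length the identity gives (2 +
-- y)(C + 1) closed walks.
C-even : ∀ y j → even j ≡ false → suc (C y (suc j)) ≡ suc y * C y j
C-even y j ev = +-cancelˡ-≡ (C y j) _ _ (begin
  C y j + suc (C y (suc j))    ≡⟨ +-suc (C y j) (C y (suc j)) ⟩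
  suc (C y j + C y (suc j))    ≡⟨ cong suc (C-step y j) ⟩
  suc (suc y ^ j)              ≡⟨ C-odd y j ev ⟨
  C y j + suc y * C y j        ∎)
  where open ≡-Reasoning

-- At j = 3 the value is y² + y + 1, so y² ≥ 3 is wanted, and y = 2 is the first case. Passing from
-- j to j + 2 only adds a nonnegative term.
C-large : ∀ y j → 2 ≤ y → 3 ≤ j → even j ≡ false → 4 + y ≤ C y j
C-large y (suc zero) 2≤y (s≤s ()) ev
C-large y (suc (suc (suc zero)))          2≤y 3≤j ev = begin
  4 + y                    ≡⟨ +-comm 4 y ⟩
  y + 4                    ≡⟨ +-assoc y 3 1 ⟨
  y + 3 + 1                ≤⟨ +-monoˡ-≤ 1 (+-monoʳ-≤ y (≤-trans (n≤1+n 3) (*-mono-≤ 2≤y 2≤y))) ⟩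
  y + y * y + 1            ≡⟨ l y ⟩
  y * (suc y * 1) + 1      ∎
  where
  open ≤-Reasoning
  l : ∀ y → y + y * y + 1 ≡ y * (suc y * 1) + 1
  l = solve-∀
C-large y (suc (suc (suc (suc zero))))    2≤y 3≤j ()
C-large y (suc (suc j@(suc (suc (suc _))))) 2≤y 3≤j ev =
  ≤-trans (C-large y j 2≤y (s≤s (s≤s (s≤s z≤n))) (not-injective (not-injective ev))) (m≤n+m (C y j) (y * suc y ^ j))

module Functional {J : Set} {y : ℕ} (f : J → Fin (2 + y) → Fin (2 + y)) (f-inj : ∀ j → Inj (f j)) where

  graph : Conflict
  graph j a b = does (f j a ≟ b)

  compose : List J → Fin (2 + y) → Fin (2 + y)
  compose []       a = a
  compose (j ∷ js) a = compose js (f j a)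

  fixed : List J → ℕ
  fixed js = sum λ a → δ (compose js a) a

  column-sum : ∀ j c → sum (λ a → 𝟙 (not (graph j a c))) ≡ suc y
  column-sum j c with a₁ , refl ← inj⇒surj (f-inj j) c = +-cancelˡ-≡ 1 _ _ (begin
    1 + sum (λ a → 𝟙 (not (graph j a c)))    ≡⟨ cong (_+ sum (λ a → 𝟙 (not (graph j a c)))) one ⟨
    sum (λ a → 𝟙 (graph j a c)) + sum (λ a → 𝟙 (not (graph j a c))) ≡⟨ sum-𝟙-not (λ a → graph j a c) ⟩
    2 + y                                    ∎)
    where
    open ≡-Reasoning
    same : ∀ a → δ (f j a) (f j a₁) ≡ δ a₁ a * 1
    same a with a₁ ≟ a
    ... | yes refl = δ-refl {a = f j a} refl
    ... | no ne    = δ-≢ (ne ∘ sym ∘ f-inj j)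
    one : sum (λ a → 𝟙 (graph j a c)) ≡ 1
    one = trans (sum-cong-≗ same) (sum-δ a₁ (λ _ → 1))

  walk-sum : ∀ js b → sum (λ a → walk graph js a b) ≡ suc y ^ length js
  walk-sum []       b = trans (sum-cong-≗ (λ a → trans (δ-sym a b) (sym (*-identityʳ _)))) (sum-δ b (λ _ → 1))
  walk-sum (j ∷ js) b = begin
    sum (λ a → sum (λ c → 𝟙 (not (graph j a c)) * walk graph js c b))   ≡⟨ ∑-comm (λ a c → 𝟙 (not (graph j a c)) * walk graph js c b) ⟩
    sum (λ c → sum (λ a → 𝟙 (not (graph j a c)) * walk graph js c b))
      ≡⟨ sum-cong-≗ (λ c → trans (sym (*-distribʳ-sum (walk graph js c b) (λ a → 𝟙 (not (graph j a c))))) (cong (_* walk graph js c b) (column-sum j c))) ⟩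
    sum (λ c → suc y * walk graph js c b)         ≡⟨ *-distribˡ-sum (suc y) (λ c → walk graph js c b) ⟨
    suc y * sum (λ c → walk graph js c b)         ≡⟨ cong (suc y *_) (walk-sum js b) ⟩
    suc y ^ suc (length js)                       ∎
    where open ≡-Reasoning

  -- The step matrix is the all-ones matrix minus a permutation matrix: the former contributes a
  -- column sum of the remaining product, the latter moves the start to `f j a`.
  walk-step : ∀ j js a b → walk graph (j ∷ js) a b + walk graph js (f j a) b ≡ suc y ^ length js
  walk-step j js a b = begin
    walk graph (j ∷ js) a b + W (f j a)
      ≡⟨ cong (walk graph (j ∷ js) a b +_) (sum-δ (f j a) W) ⟨
    sum (λ c → 𝟙 (not (graph j a c)) * W c) + sum (λ c → 𝟙 (graph j a c) * W c)
      ≡⟨ ∑-distrib-+ (λ c → 𝟙 (not (graph j a c)) * W c) (λ c → 𝟙 (graph j a c) * W c) ⟨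
    sum (λ c → 𝟙 (not (graph j a c)) * W c + 𝟙 (graph j a c) * W c)
      ≡⟨ sum-cong-≗ (λ c → trans (sym (*-distribʳ-+ (W c) (𝟙 (not (graph j a c))) _)) (trans (cong (_* W c) (𝟙-not (graph j a c))) (*-identityˡ (W c)))) ⟩
    sum W
      ≡⟨ walk-sum js b ⟩
    suc y ^ length js ∎
    where
    open ≡-Reasoning
    W = λ c → walk graph js c b

  mutual
    walk-even : ∀ js a b → even (length js) ≡ true → walk graph js a b ≡ C y (length js) + δ (compose js a) b
    walk-even []       a b ev = refl
    walk-even (j ∷ js) a b ev = +-cancelˡ-≡ W _ _ (begin
      W + walk graph (j ∷ js) a b   ≡⟨ +-comm W _ ⟩
      walk graph (j ∷ js) a b + W   ≡⟨ walk-step j js a b ⟩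
      suc y ^ length js             ≡⟨ C-step y (length js) ⟨
      C y (length js) + C′          ≡⟨ cong (_+ C′) (walk-odd js (f j a) b (not-injective ev)) ⟨
      W + δ′ + C′                   ≡⟨ l W δ′ C′ ⟩
      W + (C′ + δ′)                 ∎)
      where
      open ≡-Reasoning
      W = walk graph js (f j a) b
      C′ = C y (suc (length js))
      δ′ = δ (compose js (f j a)) b
      l : ∀ a b c → a + b + c ≡ a + (c + b)
      l = solve-∀

    walk-odd : ∀ js a b → even (length js) ≡ false → walk graph js a b + δ (compose js a) b ≡ C y (length js)
    walk-odd (j ∷ js) a b ev = +-cancelˡ-≡ (C y (length js)) _ _ (begin
      C y (length js) + (walk graph (j ∷ js) a b + δ′)   ≡⟨ l (C y (length js)) _ δ′ ⟩
      walk graph (j ∷ js) a b + (C y (length js) + δ′)   ≡⟨ cong (walk graph (j ∷ js) a b +_) (walk-even js (f j a) b (not-injective ev)) ⟨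
      walk graph (j ∷ js) a b + walk graph js (f j a) b  ≡⟨ walk-step j js a b ⟩
      suc y ^ length js                                  ≡⟨ C-step y (length js) ⟨
      C y (length js) + C y (suc (length js))            ∎)
      where
      open ≡-Reasoning
      δ′ = δ (compose js (f j a)) b
      l : ∀ a b c → a + (b + c) ≡ b + (a + c)
      l = solve-∀

  closed-even : ∀ js → even (length js) ≡ true → closed graph js ≡ (2 + y) * C y (length js) + fixed js
  closed-even js ev = begin
    closed graph js                                          ≡⟨ sum-cong-≗ (λ a → walk-even js a a ev) ⟩
    sum (λ a → C y (length js) + δ (compose js a) a)         ≡⟨ ∑-distrib-+ (λ _ → C y (length js)) (λ a → δ (compose js a) a) ⟩
    sum {2 + y} (λ _ → C y (length js)) + fixed js           ≡⟨ cong (_+ fixed js) (sum-const (2 + y) (C y (length js))) ⟩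
    (2 + y) * C y (length js) + fixed js                     ∎
    where open ≡-Reasoning

  closed-odd : ∀ js → even (length js) ≡ false → closed graph js + fixed js ≡ (2 + y) * C y (length js)
  closed-odd js ev = begin
    closed graph js + fixed js                               ≡⟨ ∑-distrib-+ (λ a → walk graph js a a) (λ a → δ (compose js a) a) ⟨
    sum (λ a → walk graph js a a + δ (compose js a) a)       ≡⟨ sum-cong-≗ (λ a → walk-odd js a a ev) ⟩
    sum {2 + y} (λ _ → C y (length js))                      ≡⟨ sum-const (2 + y) (C y (length js)) ⟩
    (2 + y) * C y (length js)                                ∎
    where open ≡-Reasoning

  fixed≤ : ∀ js → fixed js ≤ 2 + y
  fixed≤ js = ≤-trans (sum-mono (λ a → 𝟙≤1 (does (compose js a ≟ a)))) (≤-reflexive (trans (sum-const (2 + y) 1) (*-identityʳ _)))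

-- A single cycle

𝟙-does≤ : ∀ {A : Set} (d : Dec A) {n} → (A → 1 ≤ n) → 𝟙 (does d) ≤ n
𝟙-does≤ (yes a) h = h a
𝟙-does≤ (no _)  h = z≤n

C-even-pred : ∀ y n → 3 ≤ n → even n ≡ true → suc (C y n) ≡ suc y * C y (pred n)
C-even-pred y (suc n) _ ev = C-even y n (not-injective ev)

C-large-pred : ∀ y n → 2 ≤ y → 3 ≤ n → even n ≡ true → 4 + y ≤ C y (pred n)
C-large-pred y (suc (suc zero)) 2≤y (s≤s (s≤s ()))
C-large-pred y (suc n@(suc (suc (suc _)))) 2≤y _ ev = C-large y n 2≤y (s≤s (s≤s (s≤s z≤n))) (not-injective ev)

equality : ∀ {J : Set} {q} → Conflict {J} {q}
equality j a b = does (a ≟ b)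

module _ {J : Set} {y : ℕ} where

  open Functional {J} {y} (λ _ → id) (λ _ → id)

  compose-id : ∀ js a → compose js a ≡ a
  compose-id []       a = refl
  compose-id (j ∷ js) a = compose-id js a

  fixed-id : ∀ js → fixed js ≡ 2 + y
  fixed-id js = trans (sum-cong-≗ (λ a → δ-refl (compose-id js a))) (trans (sum-const (2 + y) 1) (*-identityʳ (2 + y)))

  equality-even : ∀ js → even (length js) ≡ true → closed {q = 2 + y} equality js ≡ (2 + y) * C y (length js) + (2 + y)
  equality-even js ev = trans (closed-even js ev) (cong ((2 + y) * C y (length js) +_) (fixed-id js))

  equality-odd : ∀ js → even (length js) ≡ false → closed {q = 2 + y} equality js + (2 + y) ≡ (2 + y) * C y (length js)
  equality-odd js ev = trans (cong (closed {q = 2 + y} equality js +_) (sym (fixed-id js))) (closed-odd js ev)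

  equality-pos : ∀ js → 2 ≤ y → 3 ≤ length js → 0 < closed {q = 2 + y} equality js
  equality-pos js 2≤y 3≤k with even (length js) in ev
  ... | true  = subst (0 <_) (sym (equality-even js ev)) (≤-trans (s≤s z≤n) (m≤n+m (2 + y) _))
  ... | false = +-cancelʳ-≤ (2 + y) 1 _ (begin
    1 + (2 + y)                  ≤⟨ n≤1+n _ ⟩
    4 + y                        ≤⟨ C-large y (length js) 2≤y 3≤k ev ⟩
    C y (length js)              ≤⟨ m≤m+n _ _ ⟩
    (2 + y) * C y (length js)    ≡⟨ equality-odd js ev ⟨
    closed {q = 2 + y} equality js + (2 + y) ∎)
    where open ≤-Reasoning

avoid : ∀ {J : Set} {q} → Fin (suc q) → Conflict {J} {suc q} → Conflict {J} {q}
avoid x r j a b = r j (punchIn x a) (punchIn x b)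

module OneCycle {k y : ℕ} (f : Fin k → Fin (3 + y) → Fin (3 + y)) (f-inj : ∀ j → Inj (f j))
                (js : List (Fin k)) (all∈ : ∀ j → j ∈ js) (2≤y : 2 ≤ y) (3≤len : 3 ≤ length js) where

  r : Conflict
  r j a b = does (f j a ≟ b)

  N : Fin (3 + y) → ℕ
  N x = closed (avoid x r) js

  module _ (x : Fin (3 + y)) where

    -- If `f j` moves `x`, deleting `x` leaves only a partial matching. It is completed again on the
    -- remaining 2 + y colours.
    extension : ∀ j → ∃ λ h → Inj h × (∀ a b → avoid x r j a b ≡ true → h a ≡ b)
    extension j = extend-matching (avoid x r j) ≤-refl
      (λ a b b′ p q → punchIn-injective x b b′ (trans (sym (does⇒ (f j (punchIn x a) ≟ punchIn x b) p)) (does⇒ (f j (punchIn x a) ≟ punchIn x b′) q)))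
      (λ a a′ b p q → punchIn-injective x a a′ (f-inj j (trans (does⇒ (f j (punchIn x a) ≟ punchIn x b) p) (sym (does⇒ (f j (punchIn x a′) ≟ punchIn x b) q)))))

    h : Fin k → Fin (2 + y) → Fin (2 + y)
    h j = proj₁ (extension j)

    open Functional h (λ j → proj₁ (proj₂ (extension j))) public

    avoid⊑graph : avoid x r ⊑ graph
    avoid⊑graph j a b p = dec-true (h j a ≟ b) (proj₂ (proj₂ (extension j)) a b p)

  Good : Fin (3 + y) → Set
  Good x = ∀ j → f j x ≡ x

  good? : ∀ x → Dec (Good x)
  good? x = all? (λ j → f j x ≟ x)

  good : Fin (3 + y) → Bool
  good x = does (good? x)

  others : Fin (3 + y) → ℕ
  others x = sum (λ a → 𝟙 (good (punchIn x a)))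

  -- Completion keeps existing pairs, so a colour fixed by every `f j` is fixed by every `h j`, and
  -- hence by their product.
  others≤fixed : ∀ x → others x ≤ fixed x js
  others≤fixed x = sum-mono at
    where
    compose-fix : ∀ {a} → Good (punchIn x a) → ∀ is → compose x is a ≡ a
    compose-fix     g []       = refl
    compose-fix {a} g (i ∷ is) = trans
      (cong (compose x is) (proj₂ (proj₂ (extension x i)) a a (dec-true (f i (punchIn x a) ≟ punchIn x a) (g i))))
      (compose-fix g is)
    at : ∀ a → 𝟙 (good (punchIn x a)) ≤ δ (compose x js a) a
    at a = 𝟙-does≤ (good? (punchIn x a)) λ g → ≤-reflexive (sym (δ-refl (compose-fix g js)))

  -- At odd length each fixed point of the product costs one closed walk, and the identity has the
  -- largest possible number of them.
  odd-case : even (length js) ≡ false → ∀ x → closed {q = 2 + y} equality js ≤ N x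
  odd-case ev x = ≤-trans (+-cancelʳ-≤ (2 + y) _ _ (begin
    closed {q = 2 + y} equality js + (2 + y)       ≡⟨ equality-odd js ev ⟩
    (2 + y) * C y (length js)          ≡⟨ closed-odd x js ev ⟨
    closed (graph x) js + fixed x js   ≤⟨ +-monoʳ-≤ (closed (graph x) js) (fixed≤ x js) ⟩
    closed (graph x) js + (2 + y)      ∎)) (closed-anti (avoid⊑graph x) js)
    where open ≤-Reasoning

  #bad : ℕ
  #bad = sum (𝟙 ∘ not ∘ good)

  count-good : ∀ x → 𝟙 (good x) + others x + #bad ≡ 3 + y
  count-good x = trans (cong (_+ #bad) (sym (sum-remove {i = x} (𝟙 ∘ good)))) (sum-𝟙-not good)

  module _ (ev : even (length js) ≡ true) where

    open ≤-Reasoning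

    P = closed {q = 2 + y} equality js
    Q = (2 + y) * C y (length js)

    -- As `x` is itself good, 2 + y - `#bad` good colours remain after its deletion, all of them
    -- fixed points; the identity has 2 + y.
    good-case : ∀ x → good x ≡ true → P ≤ N x + #bad
    good-case x g = begin
      P                                    ≡⟨ equality-even js ev ⟩
      Q + (2 + y)                          ≡⟨ cong (Q +_) (cong pred count) ⟨
      Q + (others x + #bad)                ≤⟨ +-monoʳ-≤ Q (+-monoˡ-≤ #bad (others≤fixed x)) ⟩
      Q + (fixed x js + #bad)              ≡⟨ +-assoc Q (fixed x js) #bad ⟨
      Q + fixed x js + #bad                ≡⟨ cong (_+ #bad) (closed-even x js ev) ⟨
      closed (graph x) js + #bad           ≤⟨ +-monoˡ-≤ #bad (closed-anti (avoid⊑graph x) js) ⟩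
      N x + #bad                           ∎
      where
      count : 1 + (others x + #bad) ≡ 3 + y
      count = trans (cong (λ b → 𝟙 b + others x + #bad) (sym g)) (count-good x)

    -- Now `x` is not good, so all 3 + y - `#bad` good colours survive its deletion, one more than
    -- in `good-case`. That one pays for the δ term given up in `c≤`, so the full amount `c` is
    -- gained.
    bad-case : ∀ x → good x ≡ false → P + C y (pred (length js)) ≤ N x + #bad
    bad-case x g with j , fjx≢x ← ¬∀⟶∃¬ k (λ j → f j x ≡ x) (λ j → f j x ≟ x) (λ all → contradiction (trans (sym g) (dec-true (good? x) all)) λ ())
                 with pre , suf , split ← ∈-∃++ (all∈ j)
                 with a′ , fa′≡x ← inj⇒surj (f-inj j) x = s≤s⁻¹ (begin
      suc (P + c)                          ≡⟨ cong (λ t → suc (t + c)) (equality-even js ev) ⟩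
      suc (Q + (2 + y) + c)                ≡⟨ l₁ Q (2 + y) c ⟩
      Q + (3 + y) + c                      ≡⟨ cong (λ t → Q + t + c) count ⟨
      Q + (others x + #bad) + c            ≤⟨ +-monoˡ-≤ c (+-monoʳ-≤ Q (+-monoˡ-≤ #bad (others≤fixed x))) ⟩
      Q + (fixed x js + #bad) + c          ≡⟨ l₂ Q (fixed x js) #bad c ⟩
      Q + fixed x js + c + #bad            ≡⟨ cong (λ t → t + c + #bad) (closed-even x js ev) ⟨
      closed (graph x) js + c + #bad       ≤⟨ +-monoˡ-≤ #bad (+-monoʳ-≤ (closed (graph x) js) c≤) ⟩
      closed (graph x) js + suc W + #bad   ≡⟨ cong (_+ #bad) (+-suc (closed (graph x) js) W) ⟩
      suc (closed (graph x) js + W + #bad) ≤⟨ s≤s (+-monoˡ-≤ #bad extra) ⟩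
      suc (N x + #bad)                     ∎)
      where
      c = C y (pred (length js))
      x≢a′ : x ≢ a′
      x≢a′ refl = fjx≢x fa′≡x
      -- The preimage of `x` under `f j` has lost its partner, and completion assigns it the new
      -- partner `b₀`. The step from `a₀` to `b₀` is thus forbidden in `graph x` but permitted in
      -- `avoid x r`.
      a₀ = punchOut x≢a′
      b₀ = h x j a₀
      W = walk (graph x) (suf ++ pre) b₀ a₀
      l₁ : ∀ q t c → suc (q + t + c) ≡ q + suc t + c
      l₁ = solve-∀
      l₂ : ∀ q f d c → q + (f + d) + c ≡ q + f + c + d
      l₂ = solve-∀
      count : others x + #bad ≡ 3 + y
      count = trans (cong (λ b → 𝟙 b + others x + #bad) (sym g)) (count-good x)
      unmatched : avoid x r j a₀ b₀ ≡ false
      unmatched = dec-false (f j (punchIn x a₀) ≟ punchIn x b₀) λ e → punchInᵢ≢i x b₀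
        (trans (sym e) (trans (cong (f j) (punchIn-punchOut x≢a′)) fa′≡x))
      extra : closed (graph x) js + W ≤ N x
      extra = subst (λ is → closed (graph x) is + W ≤ closed (avoid x r) is) (sym split)
        (closed-extra (avoid⊑graph x) pre j suf unmatched (dec-true (h x j a₀ ≟ b₀) refl))
      len : length js ≡ suc (length (suf ++ pre))
      len = trans (cong length split) (trans (length-++ pre) (trans (+-suc (length pre) (length suf)) (cong suc (trans (+-comm (length pre) (length suf)) (sym (length-++ suf))))))
      odd : even (length (suf ++ pre)) ≡ false
      odd = not-injective (trans (cong even (sym len)) ev)
      c≤ : c ≤ suc W
      c≤ = begin
        C y (pred (length js))              ≡⟨ cong (C y ∘ pred) len ⟩
        C y (length (suf ++ pre))           ≡⟨ walk-odd x (suf ++ pre) b₀ a₀ odd ⟨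
        W + δ (compose x (suf ++ pre) b₀) a₀ ≤⟨ +-monoʳ-≤ W (𝟙≤1 _) ⟩
        W + 1                               ≡⟨ +-comm W 1 ⟩
        suc W                               ∎

    P-factor : P ≡ suc (suc y) * suc y * C y (pred (length js))
    P-factor = begin-equality
      P                                              ≡⟨ equality-even js ev ⟩
      Q + (2 + y)                                    ≡⟨ +-comm Q (2 + y) ⟩
      (2 + y) + (2 + y) * C y (length js)            ≡⟨ *-suc (2 + y) (C y (length js)) ⟨
      (2 + y) * suc (C y (length js))                ≡⟨ cong ((2 + y) *_) (C-even-pred y (length js) 3≤len ev) ⟩
      (2 + y) * (suc y * C y (pred (length js)))     ≡⟨ *-assoc (2 + y) (suc y) (C y (pred (length js))) ⟨
      (2 + y) * suc y * C y (pred (length js))       ∎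

    even-case : P ^ (3 + y) ≤ prod N
    even-case = subst (λ p → p ^ (3 + y) ≤ prod N) (sym P-factor)
      (prod-bound (suc y) c N good (m≤n⇒m≤1+n 2≤y) (C-large-pred y (length js) 2≤y 3≤len ev)
        (λ x g → subst (_≤ N x + #bad) P-factor (good-case x g))
        (λ x g → subst (λ p → p + c ≤ N x + #bad) P-factor (bad-case x g)))
      where
      c = C y (pred (length js))

  cycle-bound : closed {q = 2 + y} equality js ^ (3 + y) ≤ prod N
  cycle-bound with even (length js) in ev
  ... | true  = even-case ev
  ... | false = subst (_≤ prod N) (prod-const (3 + y) (closed {q = 2 + y} equality js)) (prod-mono {f = λ _ → closed {q = 2 + y} equality js} (odd-case ev))

-- Counting colourings

private variable
  m len q : ℕ

-- Recursion on coordinates makes a count a nested sum, open to the sum lemmas and of the same shape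
-- as `walk`. `length-filter-allVecs` links it to the filtered lists of the definitions.
count : {P : Vec (Fin m) len → Set} → Decidable P → ℕ
count {len = zero}  P? = 𝟙 (does (P? []))
count {len = suc len} P? = sum λ x → count (λ c → P? (x ∷ c))

count-mono : {P Q : Vec (Fin m) len → Set} (P? : Decidable P) (Q? : Decidable Q) →
             (∀ c → P c → Q c) → count P? ≤ count Q?
count-mono {len = zero}  P? Q? h = 𝟙-does≤ (P? []) λ p → ≤-reflexive (sym (cong 𝟙 (dec-true (Q? []) (h [] p))))
count-mono {len = suc len} P? Q? h =
  sum-mono λ x → count-mono (λ c → P? (x ∷ c)) (λ c → Q? (x ∷ c)) (λ c → h (x ∷ c))

count-cong : {P Q : Vec (Fin m) len → Set} (P? : Decidable P) (Q? : Decidable Q) →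
             (∀ c → P c → Q c) → (∀ c → Q c → P c) → count P? ≡ count Q?
count-cong P? Q? h g = ≤-antisym (count-mono P? Q? h) (count-mono Q? P? g)

count-none : {P : Vec (Fin m) len → Set} (P? : Decidable P) → (∀ c → ¬ P c) → count P? ≡ 0
count-none         {len = zero}  P? h = cong 𝟙 (dec-false (P? []) (h []))
count-none {m = m} {len = suc len} P? h =
  trans (sum-cong-≗ λ x → count-none (λ c → P? (x ∷ c)) (λ c → h (x ∷ c))) (sum-replicate-zero m)

count-witness : {P : Vec (Fin m) len → Set} (P? : Decidable P) → 0 < count P? → ∃ P
count-witness {len = zero}  P? pos with P? []
... | yes p = [] , p
count-witness {m = m} {len = suc len} {P} P? pos = go m (λ x → x) pos
  where
  -- `e` enumerates the first coordinates still to be searched, so that the sum can be peeled from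
  -- the front.
  go : ∀ l (e : Fin l → Fin m) → 0 < sum (λ x → count (λ c → P? (e x ∷ c))) → ∃ P
  go (suc l) e pos with count (λ c → P? (e zero ∷ c)) in eq
  ... | zero  = go l (e ∘ suc) pos
  ... | suc _ with c , p ← count-witness (λ c → P? (e zero ∷ c)) (subst (0 <_) (sym eq) (s≤s z≤n)) = e zero ∷ c , p

count-++ : ∀ {a b} {P : Vec (Fin m) (a + b) → Set} {A : Vec (Fin m) a → Set} {B : Vec (Fin m) b → Set}
  (P? : Decidable P) (A? : Decidable A) (B? : Decidable B) →
  (∀ c d → P (c Vec.++ d) → A c × B d) → (∀ c d → A c → B d → P (c Vec.++ d)) →
  count P? ≡ count A? * count B?
count-++ {a = zero} P? A? B? h g with A? []
... | yes p = trans (count-cong P? B? (λ d → proj₂ ∘ h [] d) (λ d → g [] d p)) (sym (*-identityˡ (count B?)))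
... | no ¬p = count-none P? (λ d → ¬p ∘ proj₁ ∘ h [] d)
count-++ {a = suc a} P? A? B? h g = trans
  (sum-cong-≗ λ x → count-++ {a = a} (λ c → P? (x ∷ c)) (λ c → A? (x ∷ c)) B? (λ c → h (x ∷ c)) (λ c → g (x ∷ c)))
  (sym (*-distribʳ-sum (count B?) (λ x → count (λ c → A? (x ∷ c)))))

count-punchIn≤ : ∀ x {P : Vec (Fin (suc q)) len → Set} (P? : Decidable P) →
                 count (λ c → P? (Vec.map (punchIn x) c)) ≤ count P?
count-punchIn≤ {len = zero}  x P? = ≤-refl
count-punchIn≤ {len = suc len} x P? = begin
  sum (λ a → count (λ c → P? (punchIn x a ∷ Vec.map (punchIn x) c)))
    ≤⟨ sum-mono (λ a → count-punchIn≤ x (λ c → P? (punchIn x a ∷ c))) ⟩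
  sum (λ a → count (λ c → P? (punchIn x a ∷ c)))
    ≤⟨ m≤n+m _ (count (λ c → P? (x ∷ c))) ⟩
  count (λ c → P? (x ∷ c)) + sum (λ a → count (λ c → P? (punchIn x a ∷ c)))
    ≡⟨ sum-remove {i = x} (λ a → count (λ c → P? (a ∷ c))) ⟨
  count P? ∎
  where open ≤-Reasoning

count-punchIn : ∀ x {P : Vec (Fin (suc q)) len → Set} (P? : Decidable P) →
                (∀ c → P c → ∀ u → lookup c u ≢ x) → count P? ≡ count (λ c → P? (Vec.map (punchIn x) c))
count-punchIn {len = zero}  x P? h = refl
count-punchIn {len = suc len} x P? h = begin
  count P?
    ≡⟨ sum-remove {i = x} (λ a → count (λ c → P? (a ∷ c))) ⟩
  count (λ c → P? (x ∷ c)) + sum (λ a → count (λ c → P? (punchIn x a ∷ c)))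
    ≡⟨ cong (_+ sum (λ a → count (λ c → P? (punchIn x a ∷ c)))) (count-none (λ c → P? (x ∷ c)) (λ c p → h (x ∷ c) p zero refl)) ⟩
  sum (λ a → count (λ c → P? (punchIn x a ∷ c)))
    ≡⟨ sum-cong-≗ (λ a → count-punchIn x (λ c → P? (punchIn x a ∷ c)) (λ c p u → h (punchIn x a ∷ c) p (suc u))) ⟩
  sum (λ a → count (λ c → P? (punchIn x a ∷ Vec.map (punchIn x) c))) ∎
  where open ≡-Reasoning

length-filter-map : ∀ {A B : Set} {P : B → Set} (P? : Decidable P) (f : A → B) xs →
                    length (filter P? (List.map f xs)) ≡ length (filter (P? ∘ f) xs)
length-filter-map P? f []       = refl
length-filter-map P? f (x ∷ xs) with does (P? (f x))
... | true  = cong suc (length-filter-map P? f xs)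
... | false = length-filter-map P? f xs

-- The tail of `allFinList` is a mapped list; the accumulated maps are carried by `e`, which keeps
-- the induction going.
length-filter-concatMap : ∀ {A B : Set} {P : B → Set} (P? : Decidable P) (g : A → List B) m (e : Fin m → A) →
  length (filter P? (concatMap g (List.map e (allFinList m)))) ≡ sum λ i → length (filter P? (g (e i)))
length-filter-concatMap P? g zero    e = refl
length-filter-concatMap P? g (suc m) e = begin
  length (filter P? (g (e zero) ++ rest))
    ≡⟨ cong length (filter-++ P? (g (e zero)) rest) ⟩
  length (filter P? (g (e zero)) ++ filter P? rest)
    ≡⟨ length-++ (filter P? (g (e zero))) ⟩
  length (filter P? (g (e zero))) + length (filter P? rest)
    ≡⟨ cong (λ ys → length (filter P? (g (e zero))) + length (filter P? (concatMap g ys))) (sym (map-∘ (allFinList m))) ⟩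
  length (filter P? (g (e zero))) + length (filter P? (concatMap g (List.map (e ∘ suc) (allFinList m))))
    ≡⟨ cong (length (filter P? (g (e zero))) +_) (length-filter-concatMap P? g m (e ∘ suc)) ⟩
  sum (λ i → length (filter P? (g (e i)))) ∎
  where
  open ≡-Reasoning
  rest = concatMap g (List.map e (List.map suc (allFinList m)))

length-filter-allVecs : {P : Vec (Fin m) len → Set} (P? : Decidable P) →
                        length (filter P? (allVecs (allFinList m) len)) ≡ count P?
length-filter-allVecs {len = zero} P? with does (P? [])
... | true  = refl
... | false = refl
length-filter-allVecs {m = m} {len = suc len} P? = begin
  length (filter P? (concatMap g (allFinList m)))
    ≡⟨ cong (λ xs → length (filter P? (concatMap g xs))) (sym (map-id (allFinList m))) ⟩
  length (filter P? (concatMap g (List.map id (allFinList m))))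
    ≡⟨ length-filter-concatMap P? g m id ⟩
  sum (λ x → length (filter P? (g x)))
    ≡⟨ sum-cong-≗ (λ x → trans (length-filter-map P? (x ∷_) (allVecs (allFinList m) len)) (length-filter-allVecs (λ c → P? (x ∷ c)))) ⟩
  count P? ∎
  where
  open ≡-Reasoning
  g = λ x → List.map (x ∷_) (allVecs (allFinList m) len)

-- Conflict relations on labelled lists; joins and disjoint unions

Conflicts : ℕ → ℕ → Set
Conflicts n m = Fin n → Fin n → Fin m → Fin m → Bool

module _ {n m} (R : Conflicts n m) where
  Symmetric : Set
  Symmetric = ∀ u w a b → R u w a b ≡ R w u b a

  Matching : Set
  Matching = ∀ u w a b b′ → u ≢ w → R u w a b ≡ true → R u w a b′ ≡ true → b ≡ b′

-- Once all lists are labelled by Fin m, a cover is recorded by `R` and a vector picks one label per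
-- vertex. The relation `same` recovers proper colourings.
Valid : (G : Graph) → Conflicts (n G) m → Vec (Fin m) (n G) → Set
Valid G R c = ∀ u w → adj G u w ≡ true → R u w (lookup c u) (lookup c w) ≡ false

valid? : (G : Graph) (R : Conflicts (n G) m) → Decidable (Valid G R)
valid? G R c = all? λ u → all? λ w →
  (adj G u w Bool.≟ true) →-dec (R u w (lookup c u) (lookup c w) Bool.≟ false)

#valid : (G : Graph) → Conflicts (n G) m → ℕ
#valid G R = count (valid? G R)

same : ∀ {n m} → Conflicts n m
same u w a b = does (a ≟ b)

same-sym : ∀ {n m} → Symmetric (same {n} {m})
same-sym u w a b with a ≟ b
... | yes refl = sym (dec-true (a ≟ a) refl)
... | no a≢b   = sym (dec-false (b ≟ a) (a≢b ∘ sym))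

chromPoly≡#valid : ∀ G m → chromPoly G m ≡ #valid {m} G same
chromPoly≡#valid G m = trans (length-filter-allVecs (properVec? G)) (count-cong (properVec? G) (valid? G same)
  (λ c p u w e → dec-false (lookup c u ≟ lookup c w) (p u w e))
  (λ c v u w e eq → contradiction (trans (sym (dec-true (lookup c u ≟ lookup c w) eq)) (v u w e)) λ ()))

avoiding : ∀ {n q} → Fin (suc q) → Conflicts n (suc q) → Conflicts n q
avoiding x R u w a b = R u w (punchIn x a) (punchIn x b)

-- `fromRel` symmetrises a relation and clears its diagonal; on a relation that is already symmetric
-- and irreflexive this changes nothing.
symmetrised : ∀ {A : Set} (d : Dec A) {b b′} → b ≡ b′ → (A → b ≡ false) → (b ∨ b′) ∧ not ⌊ d ⌋ ≡ b
symmetrised (yes a) {b} refl h = trans (∧-zeroʳ (b ∨ b)) (sym (h a))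
symmetrised (no _)  {b} refl h = trans (∧-identityʳ (b ∨ b)) (∨-idem b)

module Join (G : Graph) where

  adj-join : ∀ i j → adj (K1∨ G) (suc i) (suc j) ≡ adj G i j
  adj-join i j = symmetrised (suc i ≟ suc j) (adj-sym G i j) (λ { refl → adj-irrefl G i })

  module _ {m} (R : Conflicts (suc (n G)) m) where

    inner : Conflicts (n G) m
    inner u w = R (suc u) (suc w)

    valid-join⁻ : ∀ x c → Valid (K1∨ G) R (x ∷ c) → (∀ u → R zero (suc u) x (lookup c u) ≡ false) × Valid G inner c
    valid-join⁻ x c v = (λ u → v zero (suc u) refl) , (λ u w e → v (suc u) (suc w) (trans (adj-join u w) e))

    valid-join⁺ : Symmetric R → ∀ x c → (∀ u → R zero (suc u) x (lookup c u) ≡ false) → Valid G inner c → Valid (K1∨ G) R (x ∷ c)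
    valid-join⁺ R-sym x c h v zero    zero    ()
    valid-join⁺ R-sym x c h v zero    (suc w) e = h w
    valid-join⁺ R-sym x c h v (suc u) zero    e = trans (R-sym (suc u) zero _ _) (h u)
    valid-join⁺ R-sym x c h v (suc u) (suc w) e = v u w (trans (sym (adj-join u w)) e)

  valid-avoiding : ∀ {q} (x : Fin (suc q)) (R : Conflicts (n G) (suc q)) c → Valid G (avoiding x R) c → Valid G R (Vec.map (punchIn x) c)
  valid-avoiding x R c v u w e = trans (cong₂ (R u w) (lookup-map u (punchIn x) c) (lookup-map w (punchIn x) c)) (v u w e)

  -- When the hub conflicts only with equal labels, a colouring of G avoiding `x` extends by `x` at
  -- the hub. Hub matchings may be partial, so other colourings may extend too, hence an inequality.
  #valid-join≥ : ∀ {q} (R : Conflicts (suc (n G)) (suc q)) → Symmetric R →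
    (∀ u a b → R zero (suc u) a b ≡ true → a ≡ b) →
    sum (λ x → #valid G (avoiding x (inner R))) ≤ #valid (K1∨ G) R
  #valid-join≥ R R-sym hub = sum-mono λ x → ≤-trans
    (count-mono (valid? G (avoiding x (inner R))) (λ c → valid? (K1∨ G) R (x ∷ Vec.map (punchIn x) c)) λ c v →
      valid-join⁺ R R-sym x (Vec.map (punchIn x) c) (free x c) (valid-avoiding x (inner R) c v))
    (count-punchIn≤ x (λ c → valid? (K1∨ G) R (x ∷ c)))
    where
    free : ∀ x c u → R zero (suc u) x (lookup (Vec.map (punchIn x) c) u) ≡ false
    free x c u with R zero (suc u) x (lookup (Vec.map (punchIn x) c) u) in eq
    ... | false = refl
    ... | true  = contradiction (trans (sym (lookup-map u (punchIn x) c)) (sym (hub u _ _ eq))) (punchInᵢ≢i x (lookup c u))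

  #valid-join-same : ∀ q → #valid {suc q} (K1∨ G) same ≡ suc q * #valid {q} G same
  #valid-join-same q = trans (sum-cong-≗ at) (sum-const (suc q) (#valid {q} G same))
    where
    same-punchIn : ∀ x (a b : Fin q) → does (punchIn x a ≟ punchIn x b) ≡ does (a ≟ b)
    same-punchIn x a b with a ≟ b
    ... | yes refl = dec-true (punchIn x a ≟ punchIn x a) refl
    ... | no a≢b   = dec-false (punchIn x a ≟ punchIn x b) (a≢b ∘ punchIn-injective x a b)
    to : ∀ x c → Valid (K1∨ G) same (x ∷ Vec.map (punchIn x) c) → Valid G same c
    to x c v u w e = trans (sym (same-punchIn x (lookup c u) (lookup c w)))
      (trans (cong₂ (λ a b → does (a ≟ b)) (sym (lookup-map u (punchIn x) c)) (sym (lookup-map w (punchIn x) c)))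
             (proj₂ (valid-join⁻ same x (Vec.map (punchIn x) c) v) u w e))
    from : ∀ x c → Valid G same c → Valid (K1∨ G) same (x ∷ Vec.map (punchIn x) c)
    from x c v = valid-join⁺ same same-sym x (Vec.map (punchIn x) c)
      (λ u → dec-false (x ≟ _) λ eq → punchInᵢ≢i x (lookup c u) (trans (sym (lookup-map u (punchIn x) c)) (sym eq)))
      (valid-avoiding x same c λ u w e → trans (same-punchIn x (lookup c u) (lookup c w)) (v u w e))
    at : ∀ x → count (λ c → valid? {suc q} (K1∨ G) same (x ∷ c)) ≡ #valid {q} G same
    at x = trans
      (count-punchIn x (λ c → valid? (K1∨ G) same (x ∷ c)) λ c v u eq →
        contradiction (trans (sym (dec-true (x ≟ lookup c u) (sym eq))) (proj₁ (valid-join⁻ same x c v) u)) λ ())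
      (count-cong (λ c → valid? (K1∨ G) same (x ∷ Vec.map (punchIn x) c)) (valid? G same) (to x) (from x))

module DisjointUnion (G H : Graph) where

  adj-left : ∀ i j → adj (G ⊕ H) (i ↑ˡ n H) (j ↑ˡ n H) ≡ adj G i j
  adj-left i j rewrite splitAt-↑ˡ (n G) i (n H) | splitAt-↑ˡ (n G) j (n H) =
    symmetrised (i ↑ˡ n H ≟ j ↑ˡ n H) (adj-sym G i j)
      (λ eq → trans (cong (adj G i) (sym (↑ˡ-injective (n H) i j eq))) (adj-irrefl G i))

  adj-right : ∀ i j → adj (G ⊕ H) (n G ↑ʳ i) (n G ↑ʳ j) ≡ adj H i j
  adj-right i j rewrite splitAt-↑ʳ (n G) (n H) i | splitAt-↑ʳ (n G) (n H) j =
    symmetrised (n G ↑ʳ i ≟ n G ↑ʳ j) (adj-sym H i j)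
      (λ eq → trans (cong (adj H i) (sym (↑ʳ-injective (n G) i j eq))) (adj-irrefl H i))

  adj-across : ∀ i j → adj (G ⊕ H) (i ↑ˡ n H) (n G ↑ʳ j) ≡ false
  adj-across i j rewrite splitAt-↑ˡ (n G) i (n H) | splitAt-↑ʳ (n G) (n H) j = refl

  module _ {m} (R : Conflicts (n G + n H) m) where

    left : Conflicts (n G) m
    left u w = R (u ↑ˡ n H) (w ↑ˡ n H)

    right : Conflicts (n H) m
    right u w = R (n G ↑ʳ u) (n G ↑ʳ w)

    side : (u : Fin (n G + n H)) → (∃ λ i → i ↑ˡ n H ≡ u) ⊎ (∃ λ i → n G ↑ʳ i ≡ u)
    side u with splitAt (n G) u | join-splitAt (n G) (n H) u
    ... | inj₁ i | eq = inj₁ (i , eq)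
    ... | inj₂ i | eq = inj₂ (i , eq)

    #valid-⊕ : #valid (G ⊕ H) R ≡ #valid G left * #valid H right
    #valid-⊕ = count-++ (valid? (G ⊕ H) R) (valid? G left) (valid? H right)
      (λ c d v →
        (λ u w e → trans (cong₂ (R _ _) (sym (lookup-++ˡ c d u)) (sym (lookup-++ˡ c d w))) (v _ _ (trans (adj-left u w) e))) ,
        (λ u w e → trans (cong₂ (R _ _) (sym (lookup-++ʳ c d u)) (sym (lookup-++ʳ c d w))) (v _ _ (trans (adj-right u w) e))))
      from
      where
      from : ∀ c d → Valid G left c → Valid H right d → Valid (G ⊕ H) R (c Vec.++ d)
      from c d v v′ u w e with side u | side w
      ... | inj₁ (i , refl) | inj₁ (j , refl) = trans (cong₂ (R _ _) (lookup-++ˡ c d i) (lookup-++ˡ c d j)) (v i j (trans (sym (adj-left i j)) e))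
      ... | inj₂ (i , refl) | inj₂ (j , refl) = trans (cong₂ (R _ _) (lookup-++ʳ c d i) (lookup-++ʳ c d j)) (v′ i j (trans (sym (adj-right i j)) e))
      ... | inj₁ (i , refl) | inj₂ (j , refl) = contradiction (trans (sym e) (adj-across i j)) λ ()
      ... | inj₂ (i , refl) | inj₁ (j , refl) = contradiction (trans (sym e) (trans (adj-sym (G ⊕ H) _ _) (adj-across j i))) λ ()

-- Cycles and their unions

𝟙-does-not : ∀ {A : Set} (d : Dec A) b → (A → b ≡ false) → (b ≡ false → A) → 𝟙 (does d) ≡ 𝟙 (not b)
𝟙-does-not d true  h g = cong 𝟙 (dec-false d λ a → contradiction (h a) λ ())
𝟙-does-not d false h g = cong 𝟙 (dec-true d (g refl))

count-guard : ∀ {m l} {P Q : Vec (Fin m) l → Set} (P? : Decidable P) (Q? : Decidable Q) b →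
  (∀ c → P c → b ≡ false × Q c) → (∀ c → b ≡ false → Q c → P c) → count P? ≡ 𝟙 (not b) * count Q?
count-guard P? Q? true  h g = count-none P? λ c p → contradiction (proj₁ (h c p)) λ ()
count-guard P? Q? false h g =
  trans (count-cong P? Q? (λ c → proj₂ ∘ h c) (λ c → g c refl)) (sym (*-identityˡ (count Q?)))

module _ {J : Set} {q : ℕ} (r : Conflict {J} {q}) where

  Path : ∀ {l} → (Fin (suc l) → J) → Fin q → Fin q → Vec (Fin q) l → Set
  Path js a b c = ∀ i → r (js i) (lookup (a ∷ c) i) (lookup (c ∷ʳ b) i) ≡ false

  path? : ∀ {l} (js : Fin (suc l) → J) a b → Decidable (Path js a b)
  path? js a b c = all? λ i → r (js i) (lookup (a ∷ c) i) (lookup (c ∷ʳ b) i) Bool.≟ false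

  count-path : ∀ {l} (js : Fin (suc l) → J) a b → count (path? js a b) ≡ walk r (List.tabulate js) a b
  count-path {zero} js a b = begin
    𝟙 (does (path? js a b []))                     ≡⟨ base ⟩
    𝟙 (not (r (js zero) a b))                      ≡⟨ sum-δ b (λ c → 𝟙 (not (r (js zero) a c))) ⟨
    sum (λ c → δ b c * 𝟙 (not (r (js zero) a c)))  ≡⟨ sum-cong-≗ (λ c → trans (*-comm (δ b c) _) (cong (𝟙 (not (r (js zero) a c)) *_) (δ-sym b c))) ⟩
    walk r (List.tabulate js) a b                  ∎
    where
    open ≡-Reasoning
    base : 𝟙 (does (path? js a b [])) ≡ 𝟙 (not (r (js zero) a b))
    base = 𝟙-does-not (path? js a b []) _ (λ p → p zero) (λ { eq zero → eq })
  count-path {suc l} js a b = sum-cong-≗ at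
    where
    at : ∀ c → count (λ cs → path? js a b (c ∷ cs)) ≡ 𝟙 (not (r (js zero) a c)) * walk r (List.tabulate (js ∘ suc)) c b
    at c = trans
      (count-guard (λ cs → path? js a b (c ∷ cs)) (path? (js ∘ suc) c b) (r (js zero) a c)
        (λ cs p → p zero , p ∘ suc) (λ { cs eq p zero → eq ; cs eq p (suc i) → p i }))
      (cong (𝟙 (not (r (js zero) a c)) *_) (count-path (js ∘ suc) c b))

-- The cyclic successor, encoded as a lookup in the shifted vector of indices: `lookup-next` is then
-- naturality of `lookup` under `map`, and `next-cases` recovers the arithmetic.
next : ∀ {l} → Fin (suc l) → Fin (suc l)
next {l} i = lookup (tabulate suc ∷ʳ zero) i

lookup-next : ∀ {A : Set} {l} (a : A) (c : Vec A l) i → lookup (c ∷ʳ a) i ≡ lookup (a ∷ c) (next i)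
lookup-next a c i = trans (cong (λ v → lookup v i) shifted) (lookup-map i (lookup (a ∷ c)) (tabulate suc ∷ʳ zero))
  where
  shifted : c ∷ʳ a ≡ Vec.map (lookup (a ∷ c)) (tabulate suc ∷ʳ zero)
  shifted = trans (cong (_∷ʳ a) (trans (sym (tabulate∘lookup c)) (tabulate-∘ (lookup (a ∷ c)) suc)))
                  (sym (map-∷ʳ (lookup (a ∷ c)) zero (tabulate suc)))

lookup-tabulate-∷ʳ : ∀ {A : Set} {l} (h : Fin l → A) z i →
  (∃ λ i′ → toℕ i′ ≡ toℕ i × lookup (tabulate h ∷ʳ z) i ≡ h i′) ⊎ (toℕ i ≡ l × lookup (tabulate h ∷ʳ z) i ≡ z)
lookup-tabulate-∷ʳ {l = zero}  h z zero    = inj₂ (refl , refl)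
lookup-tabulate-∷ʳ {l = suc l} h z zero    = inj₁ (zero , refl , refl)
lookup-tabulate-∷ʳ {l = suc l} h z (suc i) with lookup-tabulate-∷ʳ (h ∘ suc) z i
... | inj₁ (i′ , e , e′) = inj₁ (suc i′ , cong suc e , e′)
... | inj₂ (e , e′)      = inj₂ (cong suc e , e′)

next-cases : ∀ {l} (i : Fin (suc l)) → (toℕ (next i) ≡ suc (toℕ i)) ⊎ (toℕ i ≡ l × next i ≡ zero)
next-cases i with lookup-tabulate-∷ʳ suc zero i
... | inj₁ (i′ , e , e′) = inj₁ (trans (cong toℕ e′) (cong suc e))
... | inj₂ e             = inj₂ e

≡⇒≡ᵇ-true : ∀ {a b} → a ≡ b → (a ≡ᵇ b) ≡ true
≡⇒≡ᵇ-true {a} {b} e = Equivalence.to T-≡ (≡⇒≡ᵇ a b e)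

≡ᵇ-true⇒≡ : ∀ a b → (a ≡ᵇ b) ≡ true → a ≡ b
≡ᵇ-true⇒≡ a b e = ≡ᵇ⇒≡ a b (Equivalence.from T-≡ e)

∨-true : ∀ a {b} → a ∨ b ≡ true → a ≡ true ⊎ b ≡ true
∨-true true  e = inj₁ refl
∨-true false e = inj₂ e

∧-true : ∀ a {b} → a ∧ b ≡ true → a ≡ true × b ≡ true
∧-true true e = refl , e

next-≢ : ∀ {l} (i : Fin (2 + l)) → i ≢ next i
next-≢ i e with next-cases i
... | inj₁ e′       = contradiction (trans (cong toℕ e) e′) (<⇒≢ (n<1+n (toℕ i)))
... | inj₂ (e′ , z) = contradiction (trans (sym e′) (cong toℕ (trans e z))) λ ()

module Cycle (l : ℕ) where

  k : ℕ
  k = 2 + l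

  follows : Fin k → Fin k → Bool
  follows i j = (suc (toℕ i) ≡ᵇ toℕ j) ∨ ((suc (toℕ i) ≡ᵇ k) ∧ (toℕ j ≡ᵇ 0))

  follows-next : ∀ i → follows i (next i) ≡ true
  follows-next i with next-cases i
  ... | inj₁ e       = cong (_∨ ((suc (toℕ i) ≡ᵇ k) ∧ (toℕ (next i) ≡ᵇ 0))) (≡⇒≡ᵇ-true (sym e))
  ... | inj₂ (e , z) = trans (cong₂ (λ x y → (suc (toℕ i) ≡ᵇ toℕ (next i)) ∨ (x ∧ y)) (≡⇒≡ᵇ-true (cong suc e)) (cong ((_≡ᵇ 0) ∘ toℕ) z)) (∨-zeroʳ _)

  follows⇒next : ∀ i j → follows i j ≡ true → j ≡ next i
  follows⇒next i j f with ∨-true (suc (toℕ i) ≡ᵇ toℕ j) f | next-cases i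
  ... | inj₁ e | inj₁ e′       = toℕ-injective (trans (sym (≡ᵇ-true⇒≡ _ (toℕ j) e)) (sym e′))
  ... | inj₁ e | inj₂ (e′ , z) = contradiction (toℕ<n j) (≤⇒≯ (≤-reflexive (trans (cong suc (sym e′)) (≡ᵇ-true⇒≡ _ (toℕ j) e))))
  ... | inj₂ e | c with ∧-true (suc (toℕ i) ≡ᵇ k) e
  ...   | e₁ , e₂ with c
  ...     | inj₁ e′       = contradiction (toℕ<n (next i)) (≤⇒≯ (≤-reflexive (trans (sym (≡ᵇ-true⇒≡ _ k e₁)) (sym e′))))
  ...     | inj₂ (e′ , z) = trans (toℕ-injective (≡ᵇ-true⇒≡ (toℕ j) 0 e₂)) (sym z)

  adj-next : ∀ i → adj (cycle k) i (next i) ≡ true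
  adj-next i with i ≟ next i
  ... | yes e = contradiction e (next-≢ i)
  ... | no _  = trans (∧-identityʳ _) (cong (_∨ follows (next i) i) (follows-next i))

  adj⇒next : ∀ i j → adj (cycle k) i j ≡ true → j ≡ next i ⊎ i ≡ next j
  adj⇒next i j e with ∨-true (follows i j) (proj₁ (∧-true (follows i j ∨ follows j i) e))
  ... | inj₁ f = inj₁ (follows⇒next i j f)
  ... | inj₂ f = inj₂ (follows⇒next j i f)

  along : ∀ {q} → Conflicts k q → Conflict {Fin k} {q}
  along R j = R j (next j)

  vertices : List (Fin k)
  vertices = List.tabulate id

  -- Each edge is i with `next i` in one of the two orders. A closed walk tests one order, and
  -- symmetry of `R` supplies the other.
  #valid-cycle : ∀ {q} (R : Conflicts k q) → Symmetric R → #valid (cycle k) R ≡ closed (along R) vertices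
  #valid-cycle R R-sym = sum-cong-≗ λ a → trans
    (count-cong (λ c → valid? (cycle k) R (a ∷ c)) (path? (along R) id a a) (to a) (from a))
    (count-path (along R) id a a)
    where
    to : ∀ a c → Valid (cycle k) R (a ∷ c) → Path (along R) id a a c
    to a c v i = trans (cong (R i (next i) (lookup (a ∷ c) i)) (lookup-next a c i)) (v i (next i) (adj-next i))
    step : ∀ a c → Path (along R) id a a c → ∀ i → R i (next i) (lookup (a ∷ c) i) (lookup (a ∷ c) (next i)) ≡ false
    step a c p i = trans (cong (R i (next i) (lookup (a ∷ c) i)) (sym (lookup-next a c i))) (p i)
    from : ∀ a c → Path (along R) id a a c → Valid (cycle k) R (a ∷ c)
    from a c p i j e with adj⇒next i j e
    ... | inj₁ refl = step a c p i
    ... | inj₂ refl = trans (R-sym (next j) j _ _) (step a c p j)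

matching-column : ∀ {n m} (R : Conflicts n m) → Symmetric R → Matching R →
  ∀ u w a a′ b → u ≢ w → R u w a b ≡ true → R u w a′ b ≡ true → a ≡ a′
matching-column R R-sym R-mat u w a a′ b u≢w p p′ =
  R-mat w u b a a′ (u≢w ∘ sym) (trans (R-sym w u b a) p) (trans (R-sym w u b a′) p′)

cycle-product : ∀ {y k} → 2 ≤ y → 3 ≤ k → (R : Conflicts k (3 + y)) → Symmetric R → Matching R →
  #valid {2 + y} (cycle k) same ^ (3 + y) ≤ prod (λ x → #valid (cycle k) (avoiding x R))
cycle-product {k = suc zero} 2≤y (s≤s ())
cycle-product {y} {suc (suc l)} 2≤y 3≤k R R-sym R-mat = begin
  #valid {2 + y} (cycle k) same ^ (3 + y)
    ≡⟨ cong (_^ (3 + y)) (#valid-cycle {2 + y} same same-sym) ⟩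
  closed {q = 2 + y} equality vertices ^ (3 + y)
    ≤⟨ cycle-bound ⟩
  prod N
    ≤⟨ prod-mono (λ x → closed-anti (λ j a b e → dec-true (f j (punchIn x a) ≟ punchIn x b) (f-ext j _ _ e)) vertices) ⟩
  prod (λ x → closed (along (avoiding x R)) vertices)
    ≤⟨ prod-mono (λ x → ≤-reflexive (sym (#valid-cycle (avoiding x R) (λ u w a b → R-sym u w _ _)))) ⟩
  prod (λ x → #valid (cycle k) (avoiding x R)) ∎
  where
  open ≤-Reasoning
  open Cycle l
  -- Completion on the full lists, before any colour is deleted, makes each `f j` a bijection of all
  -- 3 + y colours.
  extension : ∀ j → ∃ λ g → Inj g × (∀ a b → R j (next j) a b ≡ true → g a ≡ b)
  extension j = extend-matching (R j (next j)) ≤-refl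
    (λ a b b′ → R-mat j (next j) a b b′ (next-≢ j))
    (λ a a′ b → matching-column R R-sym R-mat j (next j) a a′ b (next-≢ j))
  f = λ j → proj₁ (extension j)
  f-ext = λ j → proj₂ (proj₂ (extension j))
  open OneCycle f (λ j → proj₁ (proj₂ (extension j))) vertices ∈-tabulate⁺ 2≤y
    (subst (3 ≤_) (sym (length-tabulate {n = k} id)) 3≤k)

cycle-pos : ∀ {y k} → 2 ≤ y → 3 ≤ k → 0 < #valid {2 + y} (cycle k) same
cycle-pos {k = suc zero} 2≤y (s≤s ())
cycle-pos {y} {suc (suc l)} 2≤y 3≤k = subst (0 <_) (sym (#valid-cycle {2 + y} same same-sym))
  (equality-pos vertices 2≤y (subst (3 ≤_) (sym (length-tabulate {n = k} id)) 3≤k))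
  where open Cycle l

-- Both sides are multiplicative over components, since counts split along `⊕` and products over `x`
-- split factorwise. The empty union gives 1 on either side.
union-product : ∀ {y len} (ks : Vec ℕ len) → 2 ≤ y → All (3 ≤_) ks →
  (R : Conflicts (n (unionOfCycles ks)) (3 + y)) → Symmetric R → Matching R →
  #valid {2 + y} (unionOfCycles ks) same ^ (3 + y) ≤ prod (λ x → #valid (unionOfCycles ks) (avoiding x R))
union-product {y} []       2≤y []         R R-sym R-mat =
  ≤-reflexive (trans (^-zeroˡ (3 + y)) (sym (trans (prod-const (3 + y) 1) (^-zeroˡ (3 + y)))))
union-product {y} (k ∷ ks) 2≤y (3≤k ∷ 3≤ks) R R-sym R-mat = begin
  #valid {2 + y} (cycle k ⊕ U) same ^ (3 + y)
    ≡⟨ cong (_^ (3 + y)) (#valid-⊕ {2 + y} same) ⟩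
  (#valid {2 + y} (cycle k) same * #valid {2 + y} U same) ^ (3 + y)
    ≡⟨ ^-distribʳ-* (3 + y) (#valid {2 + y} (cycle k) same) (#valid {2 + y} U same) ⟩
  #valid {2 + y} (cycle k) same ^ (3 + y) * #valid {2 + y} U same ^ (3 + y)
    ≤⟨ *-mono-≤
         (cycle-product 2≤y 3≤k (left R) (λ u w → R-sym _ _) (λ u w a b b′ ne → R-mat _ _ a b b′ (ne ∘ ↑ˡ-injective (n U) u w)))
         (union-product ks 2≤y 3≤ks (right R) (λ u w → R-sym _ _) (λ u w a b b′ ne → R-mat _ _ a b b′ (ne ∘ ↑ʳ-injective k u w))) ⟩
  prod (λ x → #valid (cycle k) (avoiding x (left R))) * prod (λ x → #valid U (avoiding x (right R)))
    ≡⟨ ∏-distrib-* (λ x → #valid (cycle k) (avoiding x (left R))) (λ x → #valid U (avoiding x (right R))) ⟨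
  prod (λ x → #valid (cycle k) (avoiding x (left R)) * #valid U (avoiding x (right R)))
    ≤⟨ prod-mono (λ x → ≤-reflexive (sym (#valid-⊕ (avoiding x R)))) ⟩
  prod (λ x → #valid (cycle k ⊕ U) (avoiding x R)) ∎
  where
  open ≤-Reasoning
  U = unionOfCycles ks
  open DisjointUnion (cycle k) U

union-pos : ∀ {y len} (ks : Vec ℕ len) → 2 ≤ y → All (3 ≤_) ks → 0 < #valid {2 + y} (unionOfCycles ks) same
union-pos         []       2≤y []           = s≤s z≤n
union-pos {y} (k ∷ ks) 2≤y (3≤k ∷ 3≤ks) =
  subst (0 <_) (sym (DisjointUnion.#valid-⊕ (cycle k) (unionOfCycles ks) {2 + y} same)) (*-mono-≤ (cycle-pos {y} 2≤y 3≤k) (union-pos {y} ks 2≤y 3≤ks))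

join-bound : ∀ {y len} (ks : Vec ℕ len) → 2 ≤ y → All (3 ≤_) ks →
  (R : Conflicts (suc (n (unionOfCycles ks))) (3 + y)) → Symmetric R → Matching R →
  (∀ u a b → R zero (suc u) a b ≡ true → a ≡ b) →
  #valid {3 + y} (K1∨ (unionOfCycles ks)) same ≤ #valid (K1∨ (unionOfCycles ks)) R
join-bound {y} ks 2≤y 3≤ks R R-sym R-mat hub = begin
  #valid {3 + y} (K1∨ U) same      ≡⟨ #valid-join-same (2 + y) ⟩
  (3 + y) * #valid {2 + y} U same  ≤⟨ amgm-bound (3 + y) (λ x → #valid U (avoiding x (inner R))) (#valid {2 + y} U same)
                                        (union-product ks 2≤y 3≤ks (inner R) (λ u w → R-sym _ _)
                                          (λ u w a b b′ ne → R-mat _ _ a b b′ (ne ∘ suc-injective))) ⟩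
  sum (λ x → #valid U (avoiding x (inner R)))  ≤⟨ #valid-join≥ R R-sym hub ⟩
  #valid (K1∨ U) R                 ∎
  where
  open ≤-Reasoning
  U = unionOfCycles ks
  open Join U

-- Covers

-- Turns an injection between sets of colourings into an inequality between lengths of filtered
-- lists, the form in which both counts are defined.
unique-⊆⇒length≤ : ∀ {A : Set} {xs ys : List A} → Unique xs → (∀ {x} → x ∈ xs → x ∈ ys) → length xs ≤ length ys
unique-⊆⇒length≤ {xs = []}     _           _  = z≤n
unique-⊆⇒length≤ {xs = x ∷ xs} (x∉ ∷ uniq) xs⊆ys
  with ys₁ , ys₂ , refl ← ∈-∃++ (xs⊆ys (here refl)) = begin
  suc (length xs)                   ≤⟨ s≤s (unique-⊆⇒length≤ uniq shrink) ⟩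
  suc (length (ys₁ ++ ys₂))    ≡⟨ cong suc (length-++ ys₁) ⟩
  suc (length ys₁ + length ys₂)     ≡⟨ +-suc (length ys₁) (length ys₂) ⟨
  length ys₁ + suc (length ys₂)     ≡⟨ length-++ ys₁ ⟨
  length (ys₁ ++ x ∷ ys₂)      ∎
  where
  open ≤-Reasoning
  shrink : ∀ {z} → z ∈ xs → z ∈ ys₁ ++ ys₂
  shrink z∈ with ∈-++⁻ ys₁ (xs⊆ys (there z∈))
  ... | inj₁ z∈₁          = ∈-++⁺ˡ z∈₁
  ... | inj₂ (here refl)  = contradiction refl (ListAll.lookup x∉ z∈)
  ... | inj₂ (there z∈₂)  = ∈-++⁺ʳ ys₁ z∈₂

concatMap-map : ∀ {A B C : Set} (f : A → B → C) xs ys →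
                concatMap (λ x → List.map (f x) ys) xs ≡ cartesianProductWith f xs ys
concatMap-map f []       ys = refl
concatMap-map f (x ∷ xs) ys = cong (List.map (f x) ys ++_) (concatMap-map f xs ys)

allVecs-unique : ∀ {A : Set} {xs : List A} k → Unique xs → Unique (allVecs xs k)
allVecs-unique          zero    u = ListAll.[] ∷ []
allVecs-unique {xs = xs} (suc k) u = subst Unique (sym (concatMap-map _∷_ xs (allVecs xs k)))
  (Unique.cartesianProductWith⁺ _∷_ ∷-injective u (allVecs-unique k u))

∈-allVecs : ∀ {A : Set} {xs : List A} → (∀ x → x ∈ xs) → ∀ {k} (v : Vec A k) → v ∈ allVecs xs k
∈-allVecs          all []      = here refl
∈-allVecs {xs = xs} all {suc k} (x ∷ v) = subst (x ∷ v ∈_) (sym (concatMap-map _∷_ xs (allVecs xs k)))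
  (∈-cartesianProductWith⁺ _∷_ (all x) (∈-allVecs all v))

allFinList-unique : ∀ m → Unique (allFinList m)
allFinList-unique zero    = []
allFinList-unique (suc m) = ListAll.tabulate (λ x∈ eq → 0≢suc (∈-map⁻ suc x∈) eq) ∷ Unique.map⁺ suc-injective (allFinList-unique m)
  where
  0≢suc : ∀ {x : Fin (suc m)} → (∃ λ y → y ∈ allFinList m × x ≡ suc y) → zero ≢ x
  0≢suc (_ , _ , refl) ()

∈-allFinList : ∀ {m} (x : Fin m) → x ∈ allFinList m
∈-allFinList zero    = here refl
∈-allFinList (suc x) = there (∈-map⁺ suc (∈-allFinList x))

booleans : List Bool
booleans = true ∷ false ∷ []

booleans-unique : Unique booleans
booleans-unique = ((λ ()) ListAll.∷ ListAll.[]) ∷ ListAll.[] ∷ []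

∈-booleans : ∀ b → b ∈ booleans
∈-booleans true  = here refl
∈-booleans false = there (here refl)

-- A bijection from Fin k onto `p`, used both to label the elements of a list of known size and to
-- compute the size of a set from a listing.
record Enumeration {N} (p : Subset N) (k : ℕ) : Set where
  field
    at         : Fin k → Fin N
    at-inj     : Inj at
    at-∈       : ∀ i → at i ∈ₛ p
    surjective : ∀ {x} → x ∈ₛ p → ∃ λ i → at i ≡ x

open Enumeration

enumerate : ∀ {N} (p : Subset N) → Enumeration p ∣ p ∣
enumerate [] = record { at = λ () ; at-inj = λ { {()} } ; at-∈ = λ () ; surjective = λ () }
enumerate (outside ∷ p) = record
  { at         = suc ∘ at E
  ; at-inj     = at-inj E ∘ suc-injective
  ; at-∈       = λ i → there (at-∈ E i)
  ; surjective = λ { (there x∈) → proj₁ (surjective E x∈) , cong suc (proj₂ (surjective E x∈)) }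
  }
  where E = enumerate p
enumerate (inside ∷ p) = record
  { at         = λ { zero → zero ; (suc i) → suc (at E i) }
  ; at-inj     = λ { {zero} {zero} _ → refl ; {suc _} {suc _} eq → cong suc (at-inj E (suc-injective eq)) }
  ; at-∈       = λ { zero → here ; (suc i) → there (at-∈ E i) }
  ; surjective = λ { here → zero , refl ; (there x∈) → suc (proj₁ (surjective E x∈)) , cong suc (proj₂ (surjective E x∈)) }
  }
  where E = enumerate p

enumerations-≤ : ∀ {N k l} {p : Subset N} → Enumeration p k → Enumeration p l → k ≤ l
enumerations-≤ E F = injective⇒≤ {f = λ i → proj₁ (surjective F (at-∈ E i))} λ {i} {j} eq →
  at-inj E (trans (sym (proj₂ (surjective F (at-∈ E i)))) (trans (cong (at F) eq) (proj₂ (surjective F (at-∈ E j)))))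

enumeration-size : ∀ {N k} {p : Subset N} → Enumeration p k → ∣ p ∣ ≡ k
enumeration-size E = ≤-antisym (enumerations-≤ (enumerate _) E) (enumerations-≤ E (enumerate _))

comprehension : ∀ {N} {P : Fin N → Set} → (∀ x → Dec (P x)) → Subset N
comprehension P? = tabulate (does ∘ P?)

∈-comprehension⁺ : ∀ {N} {P : Fin N → Set} (P? : ∀ x → Dec (P x)) {x} → P x → x ∈ₛ comprehension P?
∈-comprehension⁺ P? {x} p = lookup⇒[]= x _ (trans (lookup∘tabulate (does ∘ P?) x) (dec-true (P? x) p))

∈-comprehension⁻ : ∀ {N} {P : Fin N → Set} (P? : ∀ x → Dec (P x)) {x} → x ∈ₛ comprehension P? → P x
∈-comprehension⁻ P? {x} x∈ = does⇒ (P? x) (trans (sym (lookup∘tabulate (does ∘ P?) x)) ([]=⇒lookup x∈))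

-- Colourings of a cover as conflict-free labellings

module Transversals {G : Graph} {m : ℕ} (𝓗 : Cover G m)
  (e : Fin (n G) → Fin m → Fin (n (H 𝓗)))
  (e-inj : ∀ u → Inj (e u)) (e-∈ : ∀ u a → e u a ∈ₛ L 𝓗 u) where

  conflicts : Conflicts (n G) m
  conflicts u w a b = adj (H 𝓗) (e u a) (e w b)

  conflicts-sym : Symmetric conflicts
  conflicts-sym u w a b = adj-sym (H 𝓗) (e u a) (e w b)

  conflicts-matching : Matching conflicts
  conflicts-matching u w a b b′ u≢w p p′ =
    e-inj w (matching 𝓗 u w (e u a) (e w b) (e w b′) u≢w (e-∈ u a) (e-∈ w b) (e-∈ w b′) p p′)

  colorings : List (Vec (Fin m) (n G))
  colorings = filter (valid? G conflicts) (allVecs (allFinList m) (n G))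

  hColorings : List (Subset (n (H 𝓗)))
  hColorings = filter (isHColoring? 𝓗) (allVecs booleans (n (H 𝓗)))

  In-image : Vec (Fin m) (n G) → Fin (n (H 𝓗)) → Set
  In-image c x = ∃ λ u → e u (lookup c u) ≡ x

  in-image? : ∀ c x → Dec (In-image c x)
  in-image? c x = any? λ u → e u (lookup c u) ≟ x

  image : Vec (Fin m) (n G) → Subset (n (H 𝓗))
  image c = comprehension (in-image? c)

  e-≡ : ∀ {u w a b} → e u a ≡ e w b → u ≡ w × a ≡ b
  e-≡ {u} {w} {a} {b} eq with refl ← disjoint 𝓗 (e u a) u w (e-∈ u a) (subst (_∈ₛ L 𝓗 w) (sym eq) (e-∈ w b)) = refl , e-inj u eq

  image-enumeration : ∀ c → Enumeration (image c) (n G)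
  image-enumeration c = record
    { at         = λ u → e u (lookup c u)
    ; at-inj     = proj₁ ∘ e-≡
    ; at-∈       = λ u → ∈-comprehension⁺ (in-image? c) (u , refl)
    ; surjective = ∈-comprehension⁻ (in-image? c)
    }

  image-injective : ∀ {c d} → image c ≡ image d → c ≡ d
  image-injective {c} {d} eq = trans (sym (tabulate∘lookup c)) (trans (tabulate-cong pointwise) (tabulate∘lookup d))
    where
    pointwise : ∀ u → lookup c u ≡ lookup d u
    pointwise u with w , ew ← ∈-comprehension⁻ (in-image? d) (subst (e u (lookup c u) ∈ₛ_) eq (at-∈ (image-enumeration c) u))
                with refl , p ← e-≡ ew = sym p

  image-coloring : ∀ c → Valid G conflicts c → IsHColoring 𝓗 (image c)
  image-coloring c v = enumeration-size (image-enumeration c) , indep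
    where
    indep : ∀ x y → x ∈ₛ image c → y ∈ₛ image c → adj (H 𝓗) x y ≡ false
    indep x y x∈ y∈ with ∈-comprehension⁻ (in-image? c) x∈ | ∈-comprehension⁻ (in-image? c) y∈
    ... | u , refl | w , refl with u ≟ w
    ...   | yes refl = adj-irrefl (H 𝓗) (e u (lookup c u))
    ...   | no u≢w   = ¬-not λ edge →
      contradiction (trans (sym edge) (v u w (cross 𝓗 u w _ _ u≢w (e-∈ u _) (e-∈ w _) edge))) λ ()

  #valid≤numHColorings : #valid G conflicts ≤ numHColorings 𝓗
  #valid≤numHColorings = begin
    #valid G conflicts                    ≡⟨ length-filter-allVecs (valid? G conflicts) ⟨
    length colorings                      ≡⟨ length-map image colorings ⟨
    length (List.map image colorings)     ≤⟨ unique-⊆⇒length≤ (Unique.map⁺ image-injective (Unique.filter⁺ (valid? G conflicts) (allVecs-unique (n G) (allFinList-unique m)))) sub ⟩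
    numHColorings 𝓗                       ∎
    where
    open ≤-Reasoning
    sub : ∀ {I} → I ∈ List.map image colorings → I ∈ hColorings
    sub I∈ with c , c∈ , refl ← ∈-map⁻ image I∈ =
      ∈-filter⁺ (isHColoring? 𝓗) (∈-allVecs ∈-booleans (image c))
        (image-coloring c (proj₂ (∈-filter⁻ (valid? G conflicts) {xs = allVecs (allFinList m) (n G)} c∈)))

  module _ (e-surj : ∀ u {x} → x ∈ₛ L 𝓗 u → ∃ λ a → e u a ≡ x) where

    -- Lists are cliques, so an independent set meets each at most once and `owner` is injective.
    -- With as many elements as there are lists, `owner` is also surjective, and the set picks
    -- exactly one element from each list.
    coloring-is-image : ∀ I → IsHColoring 𝓗 I → ∃ λ c → I ≡ image c × Valid G conflicts c
    coloring-is-image I (size≡ , indep) = c , I≡ , valid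
      where
      E : Enumeration I (n G)
      E = subst (Enumeration I) size≡ (enumerate I)
      owner : Fin (n G) → Fin (n G)
      owner i = proj₁ (covering 𝓗 (at E i))
      owner-∈ : ∀ i → at E i ∈ₛ L 𝓗 (owner i)
      owner-∈ i = proj₂ (covering 𝓗 (at E i))
      owner-inj : Inj owner
      owner-inj {i} {j} eq with i ≟ j
      ... | yes i≡j = i≡j
      ... | no i≢j  = contradiction
        (trans (sym (clique 𝓗 (owner i) (at E i) (at E j) (owner-∈ i) (subst (λ u → at E j ∈ₛ L 𝓗 u) (sym eq) (owner-∈ j)) (i≢j ∘ at-inj E)))
               (indep (at E i) (at E j) (at-∈ E i) (at-∈ E j))) λ ()
      chosen : ∀ u → ∃ λ a → e u a ∈ₛ I
      chosen u with i , refl ← inj⇒surj owner-inj u with a , eq ← e-surj u (owner-∈ i) = a , subst (_∈ₛ I) (sym eq) (at-∈ E i)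
      c : Vec (Fin m) (n G)
      c = tabulate (proj₁ ∘ chosen)
      c-∈ : ∀ u → e u (lookup c u) ∈ₛ I
      c-∈ u = subst (λ a → e u a ∈ₛ I) (sym (lookup∘tabulate (proj₁ ∘ chosen) u)) (proj₂ (chosen u))
      image⊆I : ∀ {x} → x ∈ₛ image c → x ∈ₛ I
      image⊆I x∈ with u , refl ← ∈-comprehension⁻ (in-image? c) x∈ = c-∈ u
      I⊆image : ∀ {x} → x ∈ₛ I → x ∈ₛ image c
      I⊆image {x} x∈ with u , x∈u ← covering 𝓗 x with x ≟ e u (lookup c u)
      ... | yes refl = ∈-comprehension⁺ (in-image? c) (u , refl)
      ... | no x≢    = contradiction (trans (sym (clique 𝓗 u x (e u (lookup c u)) x∈u (e-∈ u _) x≢)) (indep x _ x∈ (c-∈ u))) λ ()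
      I≡ : I ≡ image c
      I≡ = ⊆-antisym I⊆image image⊆I
      valid : Valid G conflicts c
      valid u w _ = indep _ _ (c-∈ u) (c-∈ w)

    numHColorings≤#valid : numHColorings 𝓗 ≤ #valid G conflicts
    numHColorings≤#valid = begin
      numHColorings 𝓗                       ≤⟨ unique-⊆⇒length≤ (Unique.filter⁺ (isHColoring? 𝓗) (allVecs-unique (n (H 𝓗)) booleans-unique)) sub ⟩
      length (List.map image colorings)     ≡⟨ length-map image colorings ⟩
      length colorings                      ≡⟨ length-filter-allVecs (valid? G conflicts) ⟩
      #valid G conflicts                    ∎
      where
      open ≤-Reasoning
      sub : ∀ {I} → I ∈ hColorings → I ∈ List.map image colorings
      sub {I} I∈ with c , refl , v ← coloring-is-image I (proj₂ (∈-filter⁻ (isHColoring? 𝓗) {xs = allVecs booleans (n (H 𝓗))} I∈)) =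
        ∈-map⁺ image (∈-filter⁺ (valid? G conflicts) (∈-allVecs ∈-allFinList c) v)

-- The cover with identity matchings, attaining the chromatic polynomial

module Canonical (G : Graph) (m : ℕ) where

  linked : Fin (n G) × Fin m → Fin (n G) × Fin m → Bool
  linked (u , a) (w , b) = (does (u ≟ w) ∧ not (does (a ≟ b))) ∨ (adj G u w ∧ does (a ≟ b))

  does-sym : ∀ {k} (a b : Fin k) → does (a ≟ b) ≡ does (b ≟ a)
  does-sym {k} a b = same-sym {n = 1} zero zero a b

  linked-sym : ∀ s t → linked s t ≡ linked t s
  linked-sym (u , a) (w , b) = cong₂ _∨_
    (cong₂ (λ x y → x ∧ not y) (does-sym u w) (does-sym a b))
    (cong₂ _∧_ (adj-sym G u w) (does-sym a b))

  linked-irrefl : ∀ s → linked s s ≡ false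
  linked-irrefl (u , a) rewrite dec-true (u ≟ u) refl | dec-true (a ≟ a) refl | adj-irrefl G u = refl

  linked-within : ∀ u {a b} → a ≢ b → linked (u , a) (u , b) ≡ true
  linked-within u {a} {b} a≢b rewrite dec-true (u ≟ u) refl | dec-false (a ≟ b) a≢b = refl

  linked-between : ∀ {u w} a b → u ≢ w → linked (u , a) (w , b) ≡ adj G u w ∧ does (a ≟ b)
  linked-between {u} {w} a b u≢w rewrite dec-false (u ≟ w) u≢w = refl

  graph : Graph
  graph = record
    { n          = n G * m
    ; adj        = λ x y → linked (remQuot m x) (remQuot m y)
    ; adj-sym    = λ x y → linked-sym (remQuot m x) (remQuot m y)
    ; adj-irrefl = λ x → linked-irrefl (remQuot m x)
    }

  vertex : Fin (n G) → Fin m → Fin (n G * m)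
  vertex = combine

  part? : ∀ u x → Dec (proj₁ (remQuot {n G} m x) ≡ u)
  part? u x = proj₁ (remQuot {n G} m x) ≟ u

  part : Fin (n G) → Subset (n G * m)
  part u = comprehension (part? u)

  part-vertex : ∀ u a → vertex u a ∈ₛ part u
  part-vertex u a = ∈-comprehension⁺ (part? u) (cong proj₁ (remQuot-combine u a))

  part-elim : ∀ u {x} → x ∈ₛ part u → ∃ λ a → vertex u a ≡ x
  part-elim u {x} x∈ with refl ← ∈-comprehension⁻ (part? u) x∈ = proj₂ (remQuot {n G} m x) , combine-remQuot {n G} m x

  adj-vertex : ∀ u w a b → adj graph (vertex u a) (vertex w b) ≡ linked (u , a) (w , b)
  adj-vertex u w a b = cong₂ linked (remQuot-combine u a) (remQuot-combine w b)

  edge-between : ∀ {u w} a b → u ≢ w → adj graph (vertex u a) (vertex w b) ≡ true → adj G u w ≡ true × a ≡ b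
  edge-between {u} {w} a b u≢w eq with e , d ← ∧-true (adj G u w) (trans (sym (trans (adj-vertex u w a b) (linked-between a b u≢w))) eq) = e , does⇒ (a ≟ b) d

  cover : Cover G m
  cover = record
    { H        = graph
    ; L        = part
    ; covering = λ x → proj₁ (remQuot {n G} m x) , ∈-comprehension⁺ (part? _) refl
    ; disjoint = λ x u w x∈u x∈w → trans (sym (∈-comprehension⁻ (part? u) x∈u)) (∈-comprehension⁻ (part? w) x∈w)
    ; size     = λ u → enumeration-size record
        { at = vertex u ; at-inj = λ {a} {b} eq → proj₂ (combine-injective u a u b eq)
        ; at-∈ = part-vertex u ; surjective = part-elim u }
    ; clique   = clique′
    ; cross    = cross′
    ; matching = matching′
    }
    where
    clique′ : ∀ u x y → x ∈ₛ part u → y ∈ₛ part u → x ≢ y → Edge graph x y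
    clique′ u x y x∈ y∈ x≢y with part-elim u x∈ | part-elim u y∈
    ... | a , refl | b , refl = trans (adj-vertex u u a b) (linked-within u (x≢y ∘ cong (vertex u)))
    cross′ : ∀ u w x y → u ≢ w → x ∈ₛ part u → y ∈ₛ part w → Edge graph x y → Edge G u w
    cross′ u w x y u≢w x∈ y∈ eq with part-elim u x∈ | part-elim w y∈
    ... | a , refl | b , refl = proj₁ (edge-between a b u≢w eq)
    matching′ : ∀ u w x y y′ → u ≢ w → x ∈ₛ part u → y ∈ₛ part w → y′ ∈ₛ part w → Edge graph x y → Edge graph x y′ → y ≡ y′
    matching′ u w x y y′ u≢w x∈ y∈ y′∈ eq eq′ with part-elim u x∈ | part-elim w y∈ | part-elim w y′∈
    ... | a , refl | b , refl | b′ , refl =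
      cong (vertex w) (trans (sym (proj₂ (edge-between a b u≢w eq))) (proj₂ (edge-between a b′ u≢w eq′)))

  open Transversals cover vertex (λ u {a} {b} eq → proj₂ (combine-injective u a u b eq)) part-vertex

  -- Along an edge of G the conflicts are equality of labels, so transversals are proper colourings.
  -- This shows that the chromatic value is attained by a cover.
  numHColorings-cover : numHColorings cover ≡ chromPoly G m
  numHColorings-cover = begin
    numHColorings cover   ≡⟨ ≤-antisym (numHColorings≤#valid part-elim) #valid≤numHColorings ⟩
    #valid G conflicts    ≡⟨ count-cong (valid? G conflicts) (valid? G same)
                               (λ c v u w e → trans (sym (on-edge e _ _)) (v u w e))
                               (λ c v u w e → trans (on-edge e _ _) (v u w e)) ⟩
    #valid {m} G same     ≡⟨ chromPoly≡#valid G m ⟨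
    chromPoly G m         ∎
    where
    open ≡-Reasoning
    on-edge : ∀ {u w} → adj G u w ≡ true → ∀ a b → conflicts u w a b ≡ does (a ≟ b)
    on-edge {u} {w} e a b = trans (adj-vertex u w a b) (trans
      (linked-between a b (λ { refl → contradiction (trans (sym e) (adj-irrefl G u)) λ () }))
      (cong (_∧ does (a ≟ b)) e))

-- Normalising the hub, and conclusion

module HubNormalised {G : Graph} {m : ℕ} (𝓗 : Cover (K1∨ G) m) where

  part : ∀ u → Enumeration (L 𝓗 u) m
  part u = subst (Enumeration (L 𝓗 u)) (size 𝓗 u) (enumerate (L 𝓗 u))

  private module Raw = Transversals 𝓗 (at ∘ part) (at-inj ∘ part) (at-∈ ∘ part)

  relabel : ∀ u → ∃ λ h → Inj h × (∀ a b → Raw.conflicts zero (suc u) a b ≡ true → h a ≡ b)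
  relabel u = extend-matching (Raw.conflicts zero (suc u)) ≤-refl
    (λ a b b′ → Raw.conflicts-matching zero (suc u) a b b′ λ ())
    (λ a a′ b → matching-column Raw.conflicts Raw.conflicts-sym Raw.conflicts-matching zero (suc u) a a′ b λ ())

  -- At a vertex of G, label `a` names the element that the completed hub matching assigns to hub
  -- label `a`; edges at the hub then join equal labels only.
  e : Fin (suc (n G)) → Fin m → Fin (n (H 𝓗))
  e zero    a = at (part zero) a
  e (suc u) a = at (part (suc u)) (proj₁ (relabel u) a)

  e-inj : ∀ u → Inj (e u)
  e-inj zero    = at-inj (part zero)
  e-inj (suc u) = proj₁ (proj₂ (relabel u)) ∘ at-inj (part (suc u))

  e-∈ : ∀ u a → e u a ∈ₛ L 𝓗 u
  e-∈ zero    a = at-∈ (part zero) a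
  e-∈ (suc u) a = at-∈ (part (suc u)) _

  open Transversals 𝓗 e e-inj e-∈ public

  hub : ∀ u a b → conflicts zero (suc u) a b ≡ true → a ≡ b
  hub u a b eq = proj₁ (proj₂ (relabel u)) (proj₂ (proj₂ (relabel u)) a (proj₁ (relabel u) b) eq)

PDP-join-cycles : ∀ {len} (ks : Vec ℕ len) → All (3 ≤_) ks → ∀ m → 5 ≤ m → PDP≡P (K1∨ (unionOfCycles ks)) m
PDP-join-cycles ks 3≤ks m@(suc (suc (suc y))) (s≤s (s≤s (s≤s 2≤y))) =
  (Canonical.cover M m , Canonical.numHColorings-cover M m) , lower
  where
  M = K1∨ (unionOfCycles ks)
  lower : (𝓗 : Cover M m) → chromPoly M m ≤ numHColorings 𝓗
  lower 𝓗 = begin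
    chromPoly M m         ≡⟨ chromPoly≡#valid M m ⟩
    #valid {m} M same     ≤⟨ join-bound ks 2≤y 3≤ks conflicts conflicts-sym conflicts-matching hub ⟩
    #valid M conflicts    ≤⟨ #valid≤numHColorings ⟩
    numHColorings 𝓗       ∎
    where
    open ≤-Reasoning
    open HubNormalised {unionOfCycles ks} 𝓗

join-pos : ∀ {len} (ks : Vec ℕ len) → All (3 ≤_) ks → 0 < #valid {5} (K1∨ (unionOfCycles ks)) same
join-pos ks 3≤ks = subst (0 <_) (sym (Join.#valid-join-same (unionOfCycles ks) 4))
  (*-mono-≤ {1} {5} (s≤s z≤n) (union-pos {2} ks ≤-refl 3≤ks))

-- The count at m = 5 is 5 times a product of positive numbers of 4-colourings of cycles, so a
-- colouring can be extracted from it without an explicit construction.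
join-cycles-colorable : ∀ {len} (ks : Vec ℕ len) → All (3 ≤_) ks → Colorable (K1∨ (unionOfCycles ks)) 5
join-cycles-colorable ks 3≤ks with c , v ← count-witness (valid? {5} (K1∨ (unionOfCycles ks)) same) (join-pos ks 3≤ks) =
  lookup c , λ u w e eq → contradiction (trans (sym (dec-true (lookup c u ≟ lookup c w) eq)) (v u w e)) λ ()

theorem3p15 : (len : ℕ) (ks : Vec ℕ len) → 2 ≤ len → All (3 ≤_) ks →
    (∀ m → 5 ≤ m → PDP≡P (K1∨ (unionOfCycles ks)) m)
    × τDP≤ (K1∨ (unionOfCycles ks)) 5
theorem3p15 len ks _ 3≤ks = PDP-join-cycles ks 3≤ks , 5 , ≤-refl , join-cycles-colorable ks 3≤ks , PDP-join-cycles ks 3≤ks
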